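{- Let $n\ge 9$. Among all connected graphs $G$ of order $n$, the quantity $\mathrm{W}(G)-\varepsilon(G)$ is maximized by the path $P_n$, and $P_n$ is the unique graph attaining this maximum.
   Context: $\mathrm{W}(G)=\sum_{\{u,v\}\subset V(G)} d(u,v)$ is the Wiener index (sum of distances over unordered pairs of distinct vertices). The eccentricity of a vertex $v$ is $\max_{u\in V(G)} d(u,v)$, and $\varepsilon(G)$ is the sum of the eccentricities of all vertices of $G$. -}

module Defs where

open import Data.Bool using (Bool; true; false; _∧_; _∨_; not; T)
open import Data.Nat using (ℕ; zero; suc; _+_; _∸_; _⊔_; _<ᵇ_; _≡ᵇ_)
open import Data.Fin using (Fin; toℕ)
open import Data.List using (List; map; foldr; allFin; concatMap)
open import Data.Nat.ListAction using (sum)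
open import Data.Bool.ListAction using (any)
open import Data.Integer using (ℤ; +_; _-_)
open import Data.Product using (Σ; ∃; _×_)
open import Data.Bool.Properties using (∨-comm)
open import Function.Bundles using (_↔_; Inverse)
open import Relation.Binary.PropositionalEquality using (_≡_; refl; cong₂)

record Graph (n : ℕ) : Set where
  field
    adj   : Fin n → Fin n → Bool
    sym   : ∀ u v → adj u v ≡ adj v u
    irrefl : ∀ u → adj u u ≡ false
open Graph public

_==_ : ∀ {n} → Fin n → Fin n → Bool
u == v = toℕ u ≡ᵇ toℕ v

reach : ∀ {n} → Graph n → ℕ → Fin n → Fin n → Bool
reach G zero    u v = u == v
reach G (suc k) u v = reach G k u v ∨ any (λ w → adj G u w ∧ reach G k w v) (allFin _)

Connected : ∀ {n} → Graph n → Set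
Connected G = ∀ u v → ∃ λ k → T (reach G k u v)

-- least k < b with p k = true, or b if none
leastBelow : ℕ → (ℕ → Bool) → ℕ
leastBelow zero    p = zero
leastBelow (suc b) p with p zero
... | true  = zero
... | false = suc (leastBelow b (λ k → p (suc k)))

-- distance: length of a shortest walk (a shortest u-v walk in a connected
-- graph of order n has length < n, so searching below n suffices).
dist : ∀ {n} → Graph n → Fin n → Fin n → ℕ
dist {n} G u v = leastBelow n (λ k → reach G k u v)

wiener : ∀ {n} → Graph n → ℕ
wiener {n} G = sum (concatMap (λ u → map (λ v → if′ (toℕ u <ᵇ toℕ v) (dist G u v)) (allFin n)) (allFin n))
  where
  if′ : Bool → ℕ → ℕ
  if′ true  m = m
  if′ false m = 0

ecc : ∀ {n} → Graph n → Fin n → ℕ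
ecc {n} G v = foldr _⊔_ 0 (map (λ u → dist G u v) (allFin n))

totalEcc : ∀ {n} → Graph n → ℕ
totalEcc {n} G = sum (map (ecc G) (allFin n))

wMinusEcc : ∀ {n} → Graph n → ℤ
wMinusEcc G = + wiener G - + totalEcc G

pathAdj : ∀ {n} → Fin n → Fin n → Bool
pathAdj i j = (suc (toℕ i) ≡ᵇ toℕ j) ∨ (suc (toℕ j) ≡ᵇ toℕ i)

private
  sm≢ᵇm : ∀ m → (suc m ≡ᵇ m) ≡ false
  sm≢ᵇm zero    = refl
  sm≢ᵇm (suc m) = sm≢ᵇm m

pathGraph : (n : ℕ) → Graph n
pathGraph n = record
  { adj = pathAdj
  ; sym = λ i j → ∨-comm (suc (toℕ i) ≡ᵇ toℕ j) (suc (toℕ j) ≡ᵇ toℕ i)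
  ; irrefl = λ i → cong₂ _∨_ (sm≢ᵇm (toℕ i)) (sm≢ᵇm (toℕ i))
  }

_≅_ : ∀ {n} → Graph n → Graph n → Set
_≅_ {n} G H = Σ (Fin n ↔ Fin n) λ σ → ∀ u v → adj G (Inverse.to σ u) (Inverse.to σ v) ≡ adj H u v

{-# OPTIONS --safe #-}
module Submission where

-- Count by thresholds: W(G) − ε(G) is the sum over t ≥ 1 of (number of pairs at distance ≥ t)
-- − (number of vertices of eccentricity ≥ t). For the path of order n = t + k the two numbers
-- are k(k+1)/2 and M t k = k + min(t, k).
-- For G of diameter D, start from a geodesic v 0, …, v D and add the remaining m = n − 1 − D
-- vertices one at a time, keeping the set S connected and measuring distances in G. A new vertex x
-- has at most k + 1 vertices at distance ≥ t in a set S of t + k vertices, since the levels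
-- 1, …, t − 1 around it are nonempty; if there are k + 1 of them and k < t, some vertex of S acquires
-- eccentricity ≥ t together with x. Hence for 3 ≤ t ≤ D (and t ≤ 2 when D ≥ 3) G does no better than
-- the path, and each level around x with two vertices makes it worse by a credit.
-- The path itself is charged the thresholds t > D, of total value −1, −2, −2, 0 for m = 1, 2, 3, 4
-- and at least 5 for m ≥ 5. For m ≤ 4 the credits suffice: an added vertex with two neighbours in S
-- gives credits for t = 2, 3, 4, and otherwise the added vertices are leaves, hanging on inner
-- vertices of the geodesic, so that the two sides of the geodesic double the levels around them.
-- If m = 0, G is the path.
open import Defs hiding (sym)
open import Data.Bool using (Bool; true; false; T; _∧_)
open import Data.Bool.Properties using (T-∨; T-∧)
open import Data.Nat using (ℕ; zero; suc; _+_; _∸_; _⊔_; _⊓_; _≤_; _<_; z≤n; s≤s; _≤?_; _<?_; _≟_; _≤ᵇ_; _<ᵇ_; _≡ᵇ_; ∣_-_∣)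
open import Data.Nat.Properties hiding (_≟_; _≤?_; _<?_)
open import Data.Nat.ListAction using (sum)
open import Data.Nat.ListAction.Properties using (sum-++; sum-↭)
open import Data.Nat.Tactic.RingSolver using (solve-∀)
open import Data.Integer using (ℤ; _⊖_) renaming (_≤_ to _≤ℤ_; _<_ to _<ℤ_)
import Data.Integer.Properties as ℤ
open import Data.Fin using (Fin; toℕ; fromℕ<)
open import Data.Fin.Properties using (toℕ<n; toℕ-injective; toℕ-fromℕ<)
import Data.Fin.Properties as Fin
open import Data.List using (List; []; _∷_; _++_; map; foldr; length; downFrom; lookup; replicate; allFin; concatMap)
open import Data.List.Properties using (map-cong; length-map; length-downFrom; length-replicate)
open import Data.List.Membership.Propositional using (_∈_; _∉_; find; lose)
open import Data.List.Membership.Propositional.Properties using (∈-map⁺; ∈-map⁻; ∈-downFrom⁺; ∈-downFrom⁻; ∈-lookup; ∈-allFin)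
open import Data.List.Membership.Propositional.Properties.WithK using (unique∧set⇒bag)
open import Data.List.Membership.DecPropositional using (_∈?_)
open import Data.List.Relation.Binary.BagAndSetEquality using (∼bag⇒↭)
open import Data.List.Relation.Binary.Permutation.Propositional using (_↭_)
import Data.List.Relation.Binary.Permutation.Propositional as ↭
open import Data.List.Relation.Binary.Permutation.Propositional.Properties using (map⁺)
open import Data.List.Relation.Unary.All as All using (All; []; _∷_)
open import Data.List.Relation.Unary.All.Properties using (¬Any⇒All¬; ++⁺)
open import Data.List.Relation.Unary.AllPairs using (AllPairs; []; _∷_)
open import Data.List.Relation.Unary.AllPairs.Properties using (tabulate⁺-<)
open import Data.List.Relation.Unary.Any as Any using (here; there)
open import Data.List.Relation.Unary.Any.Properties using (any⁺; any⁻; lookup-index)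
open import Data.List.Relation.Unary.Unique.Propositional using (Unique)
open import Data.List.Relation.Unary.Unique.Propositional.Properties using (allFin⁺)
open import Data.List.Relation.Unary.Unique.DecPropositional _≟_ using (unique?)
open import Data.Product using (∃; ∃₂; _×_; _,_; proj₁; proj₂)
open import Data.Sum using (_⊎_; inj₁; inj₂)
open import Data.Empty using (⊥; ⊥-elim)
open import Function using (_∘_; Equivalence; mk⇔; mk↔ₛ′)
open import Relation.Nullary using (¬_; Dec; yes; no)
open import Relation.Nullary.Decidable using (True; toWitness; _×-dec_; ¬?)
open import Relation.Nullary.Negation using (contradiction)
open import Relation.Binary.PropositionalEquality using (_≡_; _≢_; refl; sym; trans; cong; cong₂; subst; subst₂; module ≡-Reasoning)

-- The loss at thresholds above `D` comes from small `k`: there a path has k(k + 1)/2 pairs but may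
-- have 2k vertices to subtract, and the difference is -1, -1, 0, 2, 5 for k = 1, ..., 5. A strict
-- inequality needs one credit more than the accumulated loss. A credit at `t` takes one doubled
-- level below `t` if `k ≥ t`, that is, if the current set has at least 2t vertices; for `k < t` the
-- path itself gains a second vertex of eccentricity `t` per step, and two doubled levels are used.
-- The last vertex is added to a set of n - 1 ≥ 8 vertices, where one doubled level pays for any
-- threshold up to 4: here the 9 enters. Using distances of G makes every counted pair final, but a
-- vertex with one neighbour in `S` may have shortcuts outside `S`, so nothing follows about its
-- levels. For few added vertices the analysis therefore starts from the full vertex set and peels
-- leaves in reverse order of addition, which keeps geodesics inside the remaining set. The diameter
-- 2 exception is the claw: with three leaves it beats the path at `t = 2` by one, which is recorded
-- as a debt.

private
  variable
    A : Set

-- Finite sums and counting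

⟦_⟧ : ∀ {P : Set} → Dec P → ℕ
⟦ yes _ ⟧ = 1
⟦ no _ ⟧  = 0

⟦⟧-yes : ∀ {P : Set} (p? : Dec P) → P → ⟦ p? ⟧ ≡ 1
⟦⟧-yes (yes _) p = refl
⟦⟧-yes (no ¬p) p = contradiction p ¬p

⟦⟧-no : ∀ {P : Set} (p? : Dec P) → ¬ P → ⟦ p? ⟧ ≡ 0
⟦⟧-no (yes p) ¬p = contradiction p ¬p
⟦⟧-no (no _) _ = refl

⟦⟧≤1 : ∀ {P : Set} (p? : Dec P) → ⟦ p? ⟧ ≤ 1
⟦⟧≤1 (yes _) = ≤-refl
⟦⟧≤1 (no _) = z≤n

⟦⟧-mono : ∀ {P Q : Set} (p? : Dec P) (q? : Dec Q) → (P → Q) → ⟦ p? ⟧ ≤ ⟦ q? ⟧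
⟦⟧-mono (yes p) q? f = ≤-reflexive (sym (⟦⟧-yes q? (f p)))
⟦⟧-mono (no _) q? f = z≤n

∑ : (A → ℕ) → List A → ℕ
∑ f xs = sum (map f xs)

∑-mono : ∀ {f g : A → ℕ} xs → (∀ {y} → y ∈ xs → f y ≤ g y) → ∑ f xs ≤ ∑ g xs
∑-mono [] h = z≤n
∑-mono (x ∷ xs) h = +-mono-≤ (h (here refl)) (∑-mono xs (h ∘ there))

∑-mono-< : ∀ {f g : A → ℕ} {w} xs → (∀ {y} → y ∈ xs → f y ≤ g y) → w ∈ xs → f w < g w → ∑ f xs < ∑ g xs
∑-mono-< (x ∷ xs) h (here refl) lt = +-mono-≤ lt (∑-mono xs (h ∘ there))
∑-mono-< {f = f} (x ∷ xs) h (there w∈) lt =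
  ≤-trans (≤-reflexive (sym (+-suc (f x) _))) (+-mono-≤ (h (here refl)) (∑-mono-< xs (h ∘ there) w∈ lt))

∑-cong : ∀ {f g : A → ℕ} xs → (∀ {y} → y ∈ xs → f y ≡ g y) → ∑ f xs ≡ ∑ g xs
∑-cong [] h = refl
∑-cong (x ∷ xs) h = cong₂ _+_ (h (here refl)) (∑-cong xs (h ∘ there))

interchange : ∀ a b c e → (a + b) + (c + e) ≡ (a + c) + (b + e)
interchange = solve-∀

∑-+ : ∀ (f g : A → ℕ) xs → ∑ (λ y → f y + g y) xs ≡ ∑ f xs + ∑ g xs
∑-+ f g [] = refl
∑-+ f g (x ∷ xs) = trans (cong (f x + g x +_) (∑-+ f g xs)) (interchange (f x) (g x) _ _)

∑-zero : ∀ (xs : List A) → ∑ (λ _ → 0) xs ≡ 0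
∑-zero [] = refl
∑-zero (x ∷ xs) = ∑-zero xs

∑-one : ∀ (xs : List A) → ∑ (λ _ → 1) xs ≡ length xs
∑-one [] = refl
∑-one (x ∷ xs) = cong suc (∑-one xs)

∑-↭ : ∀ (f : A → ℕ) {xs ys} → xs ↭ ys → ∑ f xs ≡ ∑ f ys
∑-↭ f p = sum-↭ (map⁺ f p)

term≤∑ : ∀ (f : A → ℕ) {w xs} → w ∈ xs → f w ≤ ∑ f xs
term≤∑ f (here refl) = m≤m+n _ _
term≤∑ f (there w∈) = ≤-trans (term≤∑ f w∈) (m≤n+m _ _)

two-terms≤∑ : ∀ (f : A → ℕ) {a b xs} → a ≢ b → a ∈ xs → b ∈ xs → f a + f b ≤ ∑ f xs
two-terms≤∑ f a≢b (here refl) (here refl) = contradiction refl a≢b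
two-terms≤∑ f a≢b (here refl) (there b∈) = +-monoʳ-≤ _ (term≤∑ f b∈)
two-terms≤∑ f {a} {b} a≢b (there a∈) (here refl) =
  ≤-trans (≤-reflexive (+-comm (f a) (f b))) (+-monoʳ-≤ (f b) (term≤∑ f a∈))
two-terms≤∑ f a≢b (there a∈) (there b∈) = ≤-trans (two-terms≤∑ f a≢b a∈ b∈) (m≤n+m _ _)

∑-positive : ∀ {R : A → Set} (r? : ∀ y → Dec (R y)) xs → 1 ≤ ∑ (λ y → ⟦ r? y ⟧) xs → ∃ λ y → y ∈ xs × R y
∑-positive r? (x ∷ xs) pos with r? x
... | yes r = x , here refl , r
... | no _ with ∑-positive r? xs pos
... | y , y∈ , r = y , there y∈ , r

-- The range is 1, …, T.
∑₁ : ℕ → (ℕ → ℕ) → ℕ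
∑₁ zero f = 0
∑₁ (suc T) f = f (suc T) + ∑₁ T f

∑₁-mono : ∀ {f g} T → (∀ t → 1 ≤ t → t ≤ T → f t ≤ g t) → ∑₁ T f ≤ ∑₁ T g
∑₁-mono zero h = z≤n
∑₁-mono (suc T) h = +-mono-≤ (h (suc T) (s≤s z≤n) ≤-refl) (∑₁-mono T (λ t p q → h t p (m≤n⇒m≤1+n q)))

∑₁-cong : ∀ {f g} T → (∀ t → 1 ≤ t → t ≤ T → f t ≡ g t) → ∑₁ T f ≡ ∑₁ T g
∑₁-cong zero h = refl
∑₁-cong (suc T) h = cong₂ _+_ (h (suc T) (s≤s z≤n) ≤-refl) (∑₁-cong T (λ t p q → h t p (m≤n⇒m≤1+n q)))

∑₁-+ : ∀ f g T → ∑₁ T (λ t → f t + g t) ≡ ∑₁ T f + ∑₁ T g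
∑₁-+ f g zero = refl
∑₁-+ f g (suc T) = trans (cong (f (suc T) + g (suc T) +_) (∑₁-+ f g T)) (interchange (f (suc T)) (g (suc T)) _ _)

∑₁-zero : ∀ T → ∑₁ T (λ _ → 0) ≡ 0
∑₁-zero zero = refl
∑₁-zero (suc T) = ∑₁-zero T

∑₁-one : ∀ T → ∑₁ T (λ _ → 1) ≡ T
∑₁-one zero = refl
∑₁-one (suc T) = cong suc (∑₁-one T)

∑-∑₁ : ∀ (f : ℕ → A → ℕ) T xs → ∑ (λ y → ∑₁ T (λ t → f t y)) xs ≡ ∑₁ T (λ t → ∑ (f t) xs)
∑-∑₁ f T [] = sym (∑₁-zero T)
∑-∑₁ f T (x ∷ xs) = trans (cong (∑₁ T (λ t → f t x) +_) (∑-∑₁ f T xs)) (sym (∑₁-+ (λ t → f t x) _ T))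

-- The layer-cake identity: it turns sums of distances and eccentricities into counts at each
-- threshold.
layers : ∀ T e → e ≤ T → ∑₁ T (λ t → ⟦ t ≤? e ⟧) ≡ e
layers zero zero z≤n = refl
layers (suc T) e e≤ with suc T ≤? e
... | no ≰ = layers T e (≤-pred (≰⇒> ≰))
... | yes ≤e with ≤-antisym e≤ ≤e
... | refl = cong suc (trans (∑₁-cong T (λ t _ t≤ → ⟦⟧-yes (t ≤? suc T) (m≤n⇒m≤1+n t≤))) (∑₁-one T))

-- Lists of numbers serve as multisets, of doubled levels or of credited and indebted thresholds. By
-- `∑₁-mult`, multiplicities over the range add up to the length, so credits at single thresholds
-- become one total.
mult : List ℕ → ℕ → ℕ
mult as t = ∑ (λ a → ⟦ a ≟ t ⟧) as

∑₁-indicator : ∀ a T → 1 ≤ a → a ≤ T → ∑₁ T (λ t → ⟦ a ≟ t ⟧) ≡ 1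
∑₁-indicator (suc a) zero _ ()
∑₁-indicator a (suc T) 1≤a a≤ with a ≟ suc T
... | no a≢ = ∑₁-indicator a T 1≤a (≤-pred (≤∧≢⇒< a≤ a≢))
... | yes refl = cong suc (trans (∑₁-cong T (λ t _ t≤ → ⟦⟧-no (suc T ≟ t) (λ { refl → 1+n≰n t≤ }))) (∑₁-zero T))

∑₁-mult : ∀ as T → All (λ a → 1 ≤ a × a ≤ T) as → ∑₁ T (mult as) ≡ length as
∑₁-mult [] T [] = ∑₁-zero T
∑₁-mult (a ∷ as) T ((p , q) ∷ ps) =
  trans (∑₁-+ (λ t → ⟦ a ≟ t ⟧) (mult as) T) (cong₂ _+_ (∑₁-indicator a T p q) (∑₁-mult as T ps))

tri : ℕ → ℕ
tri zero = 0
tri (suc k) = suc k + tri k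

mult-∉ : ∀ as {t} → All (_≢ t) as → mult as t ≡ 0
mult-∉ [] [] = refl
mult-∉ (a ∷ as) {t} (a≢ ∷ as≢) = cong₂ _+_ (⟦⟧-no (a ≟ t) a≢) (mult-∉ as as≢)

mult-unique : ∀ {as} t → Unique as → mult as t ≡ 0 ⊎ (mult as t ≡ 1 × t ∈ as)
mult-unique t [] = inj₁ refl
mult-unique {a ∷ as} t (a∉ ∷ uq) with a ≟ t
... | yes refl = inj₂ (cong suc (mult-∉ as (flipAll a∉)) , here refl)
  where
  flipAll : ∀ {bs} → All (a ≢_) bs → All (_≢ a) bs
  flipAll [] = []
  flipAll (p ∷ ps) = (p ∘ sym) ∷ flipAll ps
... | no _ with mult-unique t uq
... | inj₁ e = inj₁ e
... | inj₂ (e , t∈) = inj₂ (e , there t∈)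

mult-replicate : ∀ c a → mult (replicate c a) a ≡ c
mult-replicate zero a = refl
mult-replicate (suc c) a = cong₂ _+_ (⟦⟧-yes (a ≟ a) refl) (mult-replicate c a)

mult-replicate-≢ : ∀ c {a r} → a ≢ r → mult (replicate c a) r ≡ 0
mult-replicate-≢ zero a≢ = refl
mult-replicate-≢ (suc c) {a} {r} a≢ = cong₂ _+_ (⟦⟧-no (a ≟ r) a≢) (mult-replicate-≢ c a≢)

all-replicate : ∀ {R : ℕ → Set} c {a} → R a → All R (replicate c a)
all-replicate zero r = []
all-replicate (suc c) r = r ∷ all-replicate c r

below above level : (A → ℕ) → ℕ → List A → ℕ
below h r S = ∑ (λ y → ⟦ h y <? r ⟧) S
above h t S = ∑ (λ y → ⟦ t ≤? h y ⟧) S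
level h r S = ∑ (λ y → ⟦ h y ≟ r ⟧) S

below≤length : ∀ (h : A → ℕ) r S → below h r S ≤ length S
below≤length h r S = ≤-trans (∑-mono S (λ {y} _ → ⟦⟧≤1 (h y <? r))) (≤-reflexive (∑-one S))

below-suc : ∀ (h : A → ℕ) r S → below h (suc r) S ≡ below h r S + level h r S
below-suc h r S = trans (∑-cong S (λ {y} _ → pointwise y)) (∑-+ _ _ S)
  where
  pointwise : ∀ y → ⟦ h y <? suc r ⟧ ≡ ⟦ h y <? r ⟧ + ⟦ h y ≟ r ⟧
  pointwise y with h y <? r | h y ≟ r
  ... | yes lt | yes refl = contradiction lt (<-irrefl refl)
  ... | yes lt | no _ = ⟦⟧-yes (h y <? suc r) (m<n⇒m<1+n lt)
  ... | no _ | yes refl = ⟦⟧-yes (h y <? suc r) ≤-refl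
  ... | no ≮ | no ≢ = ⟦⟧-no (h y <? suc r) (λ lt → ≢ (≤-antisym (≤-pred lt) (≮⇒≥ ≮)))

below+above : ∀ (h : A → ℕ) t S → below h t S + above h t S ≡ length S
below+above h t S = trans (sym (∑-+ _ _ S)) (trans (∑-cong S (λ {y} _ → pointwise y)) (∑-one S))
  where
  pointwise : ∀ y → ⟦ h y <? t ⟧ + ⟦ t ≤? h y ⟧ ≡ 1
  pointwise y with h y <? t | t ≤? h y
  ... | yes lt | yes le = contradiction lt (≤⇒≯ le)
  ... | yes _ | no _ = refl
  ... | no _ | yes _ = refl
  ... | no ≮ | no ≰ = contradiction (≮⇒≥ ≮) ≰

level≥1 : ∀ (h : A → ℕ) {r y S} → y ∈ S → h y ≡ r → 1 ≤ level h r S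
level≥1 h {r} {y} y∈ e = ≤-trans (≤-reflexive (sym (⟦⟧-yes (h y ≟ r) e))) (term≤∑ _ y∈)

level≥2 : ∀ (h : A → ℕ) {r a b S} → a ≢ b → a ∈ S → b ∈ S → h a ≡ r → h b ≡ r → 2 ≤ level h r S
level≥2 h {r} {a} {b} a≢b a∈ b∈ ea eb =
  ≤-trans (≤-reflexive (sym (cong₂ _+_ (⟦⟧-yes (h a ≟ r) ea) (⟦⟧-yes (h b ≟ r) eb)))) (two-terms≤∑ _ a≢b a∈ b∈)

∑₁-level : ∀ (h : A → ℕ) T S → level h 0 S + ∑₁ T (λ r → level h r S) ≡ below h (suc T) S
∑₁-level h zero S = trans (+-identityʳ _) (sym (trans (below-suc h 0 S)
  (cong (_+ level h 0 S) (trans (∑-cong S (λ {y} _ → ⟦⟧-no (h y <? 0) λ ())) (∑-zero S)))))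
∑₁-level h (suc T) S = trans (shift (level h 0 S) (level h (suc T) S) _)
  (trans (cong (_+ level h (suc T) S) (∑₁-level h T S)) (sym (below-suc h (suc T) S)))
  where
  shift : ∀ a b c → a + (b + c) ≡ a + c + b
  shift = solve-∀

-- The levels 0, ..., `T` partition the part below `T + 1`; each positive one holds a vertex, and
-- one more for each occurrence in `rs`. It is used for `d x` and for the collapsed height `h` of
-- `Saturated`.
spread : ∀ (h : A → ℕ) T S rs → All (λ r → 1 ≤ r × r ≤ T) rs →
  (∀ r → 1 ≤ r → r ≤ T → 1 + mult rs r ≤ level h r S) →
  level h 0 S + (T + length rs) ≤ below h (suc T) S
spread h T S rs rs-in lev = ≤-trans
  (+-monoʳ-≤ (level h 0 S) (≤-trans (≤-reflexive (sym total)) (∑₁-mono T lev)))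
  (≤-reflexive (∑₁-level h T S))
  where
  total : ∑₁ T (λ r → 1 + mult rs r) ≡ T + length rs
  total = trans (∑₁-+ (λ _ → 1) (mult rs) T) (cong₂ _+_ (∑₁-one T) (∑₁-mult rs T rs-in))

-- Metrics of connected graphs

-- The edges are the pairs at distance 1.
record GraphMetric (n : ℕ) : Set where
  field
    d        : Fin n → Fin n → ℕ
    d-refl   : ∀ u → d u u ≡ 0
    d≡0⇒≡    : ∀ {u v} → d u v ≡ 0 → u ≡ v
    d-sym    : ∀ u v → d u v ≡ d v u
    triangle : ∀ u v w → d u w ≤ d u v + d v w
    step     : ∀ {u v r} → d u v ≡ suc r → ∃ λ w → d u w ≡ 1 × d w v ≡ r

module Metric {n : ℕ} (μ : GraphMetric n) where
  open GraphMetric μ public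

  V : Set
  V = Fin n

  lipschitz : ∀ x {p q} → d p q ≡ 1 → d x q ≤ suc (d x p)
  lipschitz x {p} {q} e = ≤-trans (triangle x p q) (≤-reflexive (trans (cong (d x p +_) e) (+-comm _ 1)))

  dist-flip : ∀ {u v r} → d u v ≡ r → d v u ≡ r
  dist-flip {u} {v} e = trans (d-sym v u) e

  data Conn : List V → Set where
    single : ∀ v → Conn (v ∷ [])
    extend : ∀ {S} x {y} → y ∈ S → d x y ≡ 1 → Conn S → Conn (x ∷ S)

  -- A discrete intermediate value theorem: some edge crosses from height at most `r` to height
  -- above `r`, and a height changing by at most 1 along edges must go from `r` to `r + 1` there.
  -- The Lipschitz condition is asked only inside `S` because for the height `h` of `Saturated` it
  -- is proved only there.
  edge-at : ∀ (h : V → ℕ) {S} → Conn S →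
    (∀ {p q} → p ∈ S → q ∈ S → d p q ≡ 1 → h q ≤ suc (h p)) →
    ∀ {u w} r → u ∈ S → w ∈ S → h u ≤ r → r < h w →
    ∃₂ λ p q → p ∈ S × q ∈ S × d p q ≡ 1 × h p ≡ r × h q ≡ suc r
  edge-at h (single v) lip r (here refl) (here refl) u≤ r< = contradiction (≤-trans r< u≤) 1+n≰n
  edge-at h (extend x {y} y∈ xy conn) lip r u∈ w∈ u≤ r< = go u∈ w∈ u≤ r<
    where
    rec : ∀ {u w} → u ∈ _ → w ∈ _ → h u ≤ r → r < h w → _
    rec u∈ w∈ u≤ r< with edge-at h conn (λ p∈ q∈ → lip (there p∈) (there q∈)) r u∈ w∈ u≤ r<
    ... | p , q , p∈ , q∈ , rest = p , q , there p∈ , there q∈ , rest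
    jump : ∀ {p q} → p ∈ x ∷ _ → q ∈ x ∷ _ → d p q ≡ 1 → h p ≤ r → r < h q → _
    jump {p} {q} p∈ q∈ pq p≤ r<q =
      let hp≡r = ≤-antisym p≤ (≤-pred (≤-trans r<q (lip p∈ q∈ pq))) in
      p , q , p∈ , q∈ , pq , hp≡r , ≤-antisym (subst (λ z → h q ≤ suc z) hp≡r (lip p∈ q∈ pq)) r<q
    go : ∀ {u w} → u ∈ x ∷ _ → w ∈ x ∷ _ → h u ≤ r → r < h w →
      ∃₂ λ p q → p ∈ x ∷ _ × q ∈ x ∷ _ × d p q ≡ 1 × h p ≡ r × h q ≡ suc r
    go (here refl) (here refl) u≤ r< = contradiction (≤-trans r< u≤) 1+n≰n
    go (there u∈) (there w∈) u≤ r< = rec u∈ w∈ u≤ r<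
    go (here refl) (there w∈) u≤ r< with h y ≤? r
    ... | yes y≤ = rec y∈ w∈ y≤ r<
    ... | no y≰ = jump (here refl) (there y∈) xy u≤ (≰⇒> y≰)
    go (there u∈) (here refl) u≤ r< with h y ≤? r
    ... | yes y≤ = jump (there y∈) (here refl) (dist-flip xy) y≤ r<
    ... | no y≰ = rec u∈ y∈ u≤ (≰⇒> y≰)

  module _ {S : List V} {x : V} (conn : Conn S) (x∉S : x ∉ S) {a : V} (a∈S : a ∈ S) (xa : d x a ≡ 1) where

    d-pos : ∀ {y} → y ∈ S → 1 ≤ d x y
    d-pos {y} y∈ with d x y in e
    ... | zero = contradiction (subst (_∈ S) (sym (d≡0⇒≡ e)) y∈) x∉S
    ... | suc _ = s≤s z≤n

    level-edge : ∀ t → 1 ≤ above (d x) t S → ∀ r → 1 ≤ r → r < t →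
      ∃₂ λ p q → p ∈ S × q ∈ S × d p q ≡ 1 × d x p ≡ r × d x q ≡ suc r
    level-edge t far r 1≤r r<t with ∑-positive (λ y → t ≤? d x y) S far
    ... | b , b∈ , t≤b =
      edge-at (d x) conn (λ _ _ → lipschitz x) r a∈S b∈ (≤-trans (≤-reflexive xa) 1≤r) (≤-trans r<t t≤b)

    level-nonempty : ∀ t → 1 ≤ above (d x) t S → ∀ r → 1 ≤ r → r < t → 1 ≤ level (d x) r S
    level-nonempty t far r 1≤r r<t with level-edge t far r 1≤r r<t
    ... | p , _ , p∈ , _ , _ , e , _ = level≥1 (d x) p∈ e

    -- One vertex beyond distance `t` forces all levels 1, ..., `t` around `x` to be occupied, and
    -- those in `rs` hold two. These t + |rs| near vertices are subtracted from the t + 1 + k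
    -- vertices of `S`.
    degree-bound : ∀ t k rs → length S ≡ suc t + k → 1 ≤ above (d x) (suc t) S →
      Unique rs → All (λ r → 1 ≤ r × r ≤ t) rs → All (λ r → 2 ≤ level (d x) r S) rs →
      above (d x) (suc t) S + length rs ≤ suc k
    degree-bound t k rs len far uq rs-in rs-dbl =
      +-cancelˡ-≤ t _ _ (begin
        t + (deg + length rs)                       ≡⟨ shift t deg (length rs) ⟩
        (t + length rs) + deg                       ≤⟨ +-monoˡ-≤ deg (m≤n+m _ (level (d x) 0 S)) ⟩
        (level (d x) 0 S + (t + length rs)) + deg   ≤⟨ +-monoˡ-≤ deg (spread (d x) t S rs rs-in lev) ⟩
        below (d x) (suc t) S + deg                 ≡⟨ below+above (d x) (suc t) S ⟩
        length S                                  ≡⟨ len ⟩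
        suc t + k                                 ≡⟨ sym (+-suc t k) ⟩
        t + suc k                                 ∎)
      where
      open ≤-Reasoning
      deg = above (d x) (suc t) S
      shift : ∀ a b c → a + (b + c) ≡ (a + c) + b
      shift = solve-∀
      pick : ∀ {r rs} → r ∈ rs → All (λ r → 2 ≤ level (d x) r S) rs → 2 ≤ level (d x) r S
      pick (here refl) (p ∷ _) = p
      pick (there r∈) (_ ∷ ps) = pick r∈ ps
      lev : ∀ r → 1 ≤ r → r ≤ t → 1 + mult rs r ≤ level (d x) r S
      lev r 1≤r r≤t with mult-unique r uq
      ... | inj₁ e = ≤-trans (≤-reflexive (cong suc e)) (level-nonempty (suc t) far r 1≤r (s≤s r≤t))
      ... | inj₂ (e , r∈) = ≤-trans (≤-reflexive (cong suc e)) (pick r∈ rs-dbl)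

  -- S ∪ {x} has t + k + 1 vertices and k + 1 of them are at distance ≥ t from x, so the
  -- levels 1, …, t − 1 around x are singletons forming a path that ends at u, and the far
  -- part hangs on u. If the neighbour w of u in the far part had a vertex at distance ≥ t,
  -- the far part would be w and a path from a further neighbour q of u, and then all of S is within t − 1 of q.
  module Saturated (c k : ℕ) {S : List V} {x : V} (conn : Conn S) (x∉S : x ∉ S)
    {a : V} (a∈S : a ∈ S) (xa : d x a ≡ 1)
    (len : length S ≡ suc (suc c) + k) (sat : above (d x) (suc (suc c)) S ≡ suc k)
    (k<t : k < suc (suc c)) where

    t : ℕ
    t = suc (suc c)

    g : V → ℕ
    g = d x

    far : 1 ≤ above g t S
    far = ≤-trans (s≤s z≤n) (≤-reflexive (sym sat))

    below-g : below g t S ≡ suc c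
    below-g = +-cancelʳ-≡ (suc k) _ _ (trans (cong (below g t S +_) (sym sat))
      (trans (below+above g t S) (trans len (sym (+-suc (suc c) k)))))

    -- A second vertex on a level below `t` would, by `degree-bound`, leave room for only `k` far
    -- vertices.
    unique-level : ∀ {p q} → p ∈ S → q ∈ S → g q < t → g p ≡ g q → p ≡ q
    unique-level {p} {q} p∈ q∈ q<t e with p Fin.≟ q
    ... | yes eq = eq
    ... | no p≢q = contradiction (subst (λ z → z + 1 ≤ suc k) sat bound) (m+1+n≰m (suc k))
      where
      bound : above g t S + 1 ≤ suc k
      bound = degree-bound conn x∉S a∈S xa (suc c) k (g q ∷ []) len far
        ([] ∷ []) ((d-pos conn x∉S a∈S xa q∈ , ≤-pred q<t) ∷ []) (level≥2 g p≢q p∈ q∈ e refl ∷ [])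

    abstract
      last-edge : ∃₂ λ p q → p ∈ S × q ∈ S × d p q ≡ 1 × g p ≡ suc c × g q ≡ t
      last-edge = level-edge conn x∉S a∈S xa t far (suc c) (s≤s z≤n) ≤-refl

    u w : V
    u = proj₁ last-edge
    w = proj₁ (proj₂ last-edge)

    u∈ : u ∈ S
    u∈ = proj₁ (proj₂ (proj₂ last-edge))

    w∈ : w ∈ S
    w∈ = proj₁ (proj₂ (proj₂ (proj₂ last-edge)))

    uw : d u w ≡ 1
    uw = proj₁ (proj₂ (proj₂ (proj₂ (proj₂ last-edge))))

    gu : g u ≡ suc c
    gu = proj₁ (proj₂ (proj₂ (proj₂ (proj₂ (proj₂ last-edge)))))

    gw : g w ≡ t
    gw = proj₂ (proj₂ (proj₂ (proj₂ (proj₂ (proj₂ last-edge)))))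

    -- An edge leaving the level of `y` upwards starts at `y` itself, since the level is a
    -- singleton; following such edges leads to `u`.
    tail-dist : ∀ s {y} → y ∈ S → g y + s ≡ suc c → d u y ≤ s
    tail-dist zero {y} y∈ e = ≤-reflexive (trans (cong (d u)
      (unique-level y∈ u∈ (≤-reflexive (cong suc gu)) (trans (sym (+-identityʳ _)) (trans e (sym gu))))) (d-refl u))
    tail-dist (suc s) {y} y∈ e with level-edge conn x∉S a∈S xa t far (g y) (d-pos conn x∉S a∈S xa y∈)
      (s≤s (≤-trans (m≤m+n _ _) (≤-reflexive e)))
    ... | p , q , p∈ , q∈ , pq , gp , gq
      with unique-level p∈ y∈ (s≤s (≤-trans (m≤m+n _ _) (≤-reflexive e))) gp
    ... | refl = ≤-trans (lipschitz u (dist-flip pq))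
      (s≤s (tail-dist s q∈ (trans (cong (_+ s) gq) (trans (sym (+-suc _ s)) e))))

    -- The route through `u` has length at most 1 + (t - 1 - g y), and `g y ≥ 1` because `x ∉ S`. It
    -- is needed for two neighbours of `u`: for `w` and for `q`.
    near : ∀ {f y} → d f u ≡ 1 → y ∈ S → g y < t → d f y < t
    near {f} {y} fu y∈ y<t with m≤n⇒∃[o]m+o≡n (≤-pred y<t)
    ... | s , e = s≤s (≤-trans (triangle f u y) (≤-trans (≤-reflexive (cong (_+ d u y) fu))
      (s≤s (≤-trans (tail-dist s y∈ e) s≤c))))
      where
      s≤c : s ≤ c
      s≤c = ≤-pred (≤-trans (+-monoˡ-≤ s (d-pos conn x∉S a∈S xa y∈)) (≤-reflexive e))

    boundary : ∀ {p q} → p ∈ S → d p q ≡ 1 → g p < t → t ≤ g q → p ≡ u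
    boundary p∈ pq p<t t≤q = unique-level p∈ u∈ (≤-reflexive (cong suc gu))
      (trans (≤-antisym (≤-pred p<t) (≤-pred (≤-trans t≤q (lipschitz x pq)))) (sym gu))

    merge : ∀ {m} → Dec (m < t) → ℕ → ℕ
    merge (yes _) _ = 1
    merge (no _) e = e

    -- Height around `w`, with the whole near part collapsed to the height 1 of `u`. Near and far
    -- part meet only at `u`, so `h` stays Lipschitz on `S`, while all `t - 1` near vertices now
    -- count on level 1.
    h : V → ℕ
    h y = merge (g y <? t) (d w y)

    h-near : ∀ {y} → g y < t → h y ≡ 1
    h-near {y} lt with g y <? t
    ... | yes _ = refl
    ... | no ≮ = contradiction lt ≮

    h-far : ∀ {y} → t ≤ g y → h y ≡ d w y
    h-far {y} le with g y <? t
    ... | yes lt = contradiction lt (≤⇒≯ le)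
    ... | no _ = refl

    h≢1⇒far : ∀ {y} → h y ≢ 1 → t ≤ g y
    h≢1⇒far {y} ≢1 = ≮⇒≥ (≢1 ∘ h-near)

    h-lip : ∀ {p q} → p ∈ S → q ∈ S → d p q ≡ 1 → h q ≤ suc (h p)
    h-lip {p} {q} p∈ q∈ pq with g q <? t | g p <? t
    ... | yes _ | _ = s≤s z≤n
    ... | no _ | no _ = lipschitz w pq
    ... | no q≮ | yes p<t with boundary p∈ pq p<t (≮⇒≥ q≮)
    ... | refl = ≤-trans (lipschitz w pq) (s≤s (≤-reflexive (dist-flip uw)))

    hw : h w ≡ 0
    hw = trans (h-far (≤-reflexive (sym gw))) (d-refl w)

    module _ (y₀ : V) (y₀∈ : y₀ ∈ S) (t≤y₀ : t ≤ d w y₀) where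

      y₀-far : t ≤ g y₀
      y₀-far = ≮⇒≥ (λ lt → ≤⇒≯ t≤y₀ (near (dist-flip uw) y₀∈ lt))

      h-edge : ∀ r → r < t → ∃₂ λ p q → p ∈ S × q ∈ S × d p q ≡ 1 × h p ≡ r × h q ≡ suc r
      h-edge r r<t = edge-at h conn h-lip r w∈ y₀∈ (≤-trans (≤-reflexive hw) z≤n)
        (≤-trans r<t (≤-trans t≤y₀ (≤-reflexive (sym (h-far y₀-far)))))

      h-level≥1 : ∀ r → 1 ≤ r → r ≤ t → 1 ≤ level h r S
      h-level≥1 (suc r) _ r<t with h-edge r r<t
      ... | p , q , _ , q∈ , _ , _ , hq = level≥1 h q∈ hq

      h-level1 : suc c ≤ level h 1 S
      h-level1 = ≤-trans (≤-reflexive (sym below-g))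
        (∑-mono S (λ {y} _ → ⟦⟧-mono (g y <? t) (h y ≟ 1) h-near))

      count : ∀ rs → All (λ r → 1 ≤ r × r ≤ t) rs →
        (∀ r → 1 ≤ r → r ≤ t → 1 + mult rs r ≤ level h r S) → 1 + (t + length rs) ≤ below h (suc t) S
      count rs rs-in lev = ≤-trans (+-monoˡ-≤ (t + length rs) (level≥1 h w∈ hw)) (spread h t S rs rs-in lev)

      ≤k : ∀ {m} → 1 + (t + m) ≤ length S → suc m ≤ k
      ≤k {m} le = +-cancelˡ-≤ t _ _ (≤-trans (≤-reflexive (+-suc t m)) (≤-trans le (≤-reflexive len)))

      levels-tail : ∀ r → 1 ≤ r → r ≤ t → 1 + mult (replicate c 1) r ≤ level h r S
      levels-tail r 1≤r r≤t with 1 ≟ r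
      ... | yes refl = ≤-trans (≤-reflexive (cong suc (mult-replicate c 1))) h-level1
      ... | no 1≢r = ≤-trans (≤-reflexive (cong suc (mult-replicate-≢ c 1≢r))) (h-level≥1 r 1≤r r≤t)

      1-in : 1 ≤ 1 × 1 ≤ t
      1-in = ≤-refl , s≤s z≤n

      -- `w` is on level 0, the `c + 1` near vertices are on level 1, and each of the levels 2, ...,
      -- `t` is met on the way to `y₀`.
      count-tail : 1 + (t + c) ≤ below h (suc t) S
      count-tail = subst (λ z → 1 + (t + z) ≤ below h (suc t) S) (length-replicate c)
        (count (replicate c 1) (all-replicate c 1-in) levels-tail)

      c<k : suc c ≤ k
      c<k = ≤k (≤-trans count-tail (below≤length h (suc t) S))

      k≡ : k ≡ suc c
      k≡ = ≤-antisym (≤-pred k<t) c<k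

      -- With `k = c + 1` the vertices counted in `count-tail` are already all of `S`. The lemmas
      -- `h-unique`, `h≡1⇒near` and `h≤t` each exclude one kind of surplus vertex in this way.
      overfull : 1 + (t + suc c) ≤ length S → ⊥
      overfull le = <-irrefl (sym k≡) (≤k le)

      h-unique : ∀ {p q} r → 2 ≤ r → r ≤ t → p ∈ S → q ∈ S → h p ≡ r → h q ≡ r → p ≡ q
      h-unique {p} {q} r 2≤r r≤t p∈ q∈ hp hq with p Fin.≟ q
      ... | yes e = e
      ... | no p≢q = ⊥-elim (overfull (≤-trans
        (subst (λ z → 1 + (t + suc z) ≤ below h (suc t) S) (length-replicate c)
          (count (r ∷ replicate c 1) ((≤-trans (n≤1+n 1) 2≤r , r≤t) ∷ all-replicate c 1-in) lev))
        (below≤length h (suc t) S)))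
        where
        lev : ∀ s → 1 ≤ s → s ≤ t → 1 + mult (r ∷ replicate c 1) s ≤ level h s S
        lev s 1≤s s≤t with r ≟ s
        ... | no _ = levels-tail s 1≤s s≤t
        ... | yes refl = ≤-trans (≤-reflexive (cong (2 +_) (mult-replicate-≢ c (λ { refl → 1+n≰n 2≤r }))))
          (level≥2 h p≢q p∈ q∈ hp hq)

      h≡1⇒near : ∀ {y} → y ∈ S → h y ≡ 1 → g y < t
      h≡1⇒near {y} y∈ hy with g y <? t in e
      ... | yes lt = lt
      ... | no ≮ = ⊥-elim (overfull (≤-trans
        (subst (λ z → 1 + (t + suc z) ≤ below h (suc t) S) (length-replicate c)
          (count (replicate (suc c) 1) (all-replicate (suc c) 1-in) lev))
        (below≤length h (suc t) S)))
        where
        h-level1′ : suc (suc c) ≤ level h 1 S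
        h-level1′ = ≤-trans (s≤s (≤-reflexive (sym below-g)))
          (∑-mono-< S (λ {y} _ → ⟦⟧-mono (g y <? t) (h y ≟ 1) h-near) y∈
            (≤-trans (s≤s (≤-reflexive (⟦⟧-no (g y <? t) ≮)))
              (≤-reflexive (sym (⟦⟧-yes (h y ≟ 1) (trans (h-far (≮⇒≥ ≮)) hy))))))
        lev : ∀ r → 1 ≤ r → r ≤ t → 1 + mult (replicate (suc c) 1) r ≤ level h r S
        lev r 1≤r r≤t with 1 ≟ r
        ... | yes refl = ≤-trans (≤-reflexive (cong (2 +_) (mult-replicate c 1))) h-level1′
        ... | no 1≢r = ≤-trans (≤-reflexive (cong suc (mult-replicate-≢ c 1≢r))) (h-level≥1 r 1≤r r≤t)

      h≤t : ∀ {y} → y ∈ S → h y ≤ t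
      h≤t {y} y∈ with h y ≤? t
      ... | yes le = le
      ... | no ≰ = ⊥-elim (overfull (≤-trans
        (≤-reflexive (cong suc (+-suc t c))) (≤-trans (s≤s count-tail)
        (≤-trans (∑-mono-< S (λ {z} _ → ⟦⟧≤1 (h z <? suc t)) y∈
          (s≤s (≤-reflexive (⟦⟧-no (h y <? suc t) (λ lt → ≰ (≤-pred lt)))))) (≤-reflexive (∑-one S))))))

      -- The edge from height 1 to height 2 leaves the near part, and only `u` has an edge out of
      -- it.
      q-data : 3 ≤ t → ∃ λ q → q ∈ S × t ≤ g q × d q u ≡ 1 × d w q ≡ 2 × h q ≡ 2
      q-data 3≤t with h-edge 1 (≤-trans (n≤1+n 2) 3≤t)
      ... | p , q , p∈ , q∈ , pq , hp , hq = q , q∈ , q-far ,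
        dist-flip (subst (λ z → d z q ≡ 1) (boundary p∈ pq (h≡1⇒near p∈ hp) q-far) pq) ,
        trans (sym (h-far q-far)) hq , hq
        where
        q-far : t ≤ g q
        q-far = h≢1⇒far (λ e → contradiction (trans (sym hq) e) λ ())

      h-path : ∀ {q} → q ∈ S → h q ≡ 2 → ∀ s {y} → y ∈ S → h y ≡ 2 + s → d q y ≤ s
      h-path {q} q∈ hq zero {y} y∈ hy =
        ≤-reflexive (trans (cong (d q) (h-unique 2 ≤-refl (s≤s (s≤s z≤n)) y∈ q∈ hy hq)) (d-refl q))
      h-path {q} q∈ hq (suc s) {y} y∈ hy with h-edge (2 + s) (≤-trans (≤-reflexive (sym hy)) (h≤t y∈))
      ... | p , y′ , p∈ , y′∈ , py , hp , hy′
        with h-unique (3 + s) (s≤s (s≤s z≤n)) (≤-trans (≤-reflexive (sym hy)) (h≤t y∈)) y′∈ y∈ hy′ hy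
      ... | refl = ≤-trans (lipschitz q py) (s≤s (h-path q∈ hq s p∈ hp))

      q-isolated : 3 ≤ t → ∃ λ q → q ∈ S × t ≤ g q × (∀ {y} → y ∈ S → d q y < t)
      q-isolated 3≤t with q-data 3≤t
      ... | q , q∈ , q-far , qu , wq , hq = q , q∈ , q-far , isolated
        where
        isolated : ∀ {y} → y ∈ S → d q y < t
        isolated {y} y∈ with g y <? t
        ... | yes lt = near qu y∈ lt
        ... | no ≮ with h y in hy
        -- A far vertex of height 0 is `w`, at distance 2 from `q`; here `3 ≤ t` is used.
        ... | zero = subst (_< t) (trans (sym (dist-flip wq)) (cong (d q) (d≡0⇒≡ (trans (sym (h-far (≮⇒≥ ≮))) hy)))) 3≤t
        ... | suc zero = contradiction (h≡1⇒near y∈ hy) ≮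
        ... | suc (suc s) = ≤-trans (s≤s (h-path q∈ hq s y∈ hy))
          (≤-trans (n≤1+n _) (≤-trans (≤-reflexive (sym hy)) (h≤t y∈)))

    isolated-far-vertex : 3 ≤ t → ∃ λ z → z ∈ S × t ≤ g z × (∀ {y} → y ∈ S → d z y < t)
    isolated-far-vertex 3≤t with 1 ≤? above (d w) t S
    ... | no ≱ = w , w∈ , ≤-reflexive (sym gw) , λ {y} y∈ → ≰⇒> (λ t≤ → ≱
      (≤-trans (≤-reflexive (sym (⟦⟧-yes (t ≤? d w y) t≤))) (term≤∑ (λ y → ⟦ t ≤? d w y ⟧) y∈)))
    ... | yes pos with ∑-positive (λ y → t ≤? d w y) S pos
    ... | y₀ , y₀∈ , le = q-isolated y₀ y₀∈ le 3≤t

-- Counts of eccentricities in a path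

⟦⟧-⇔ : ∀ {P Q : Set} (p? : Dec P) (q? : Dec Q) → (P → Q) → (Q → P) → ⟦ p? ⟧ ≡ ⟦ q? ⟧
⟦⟧-⇔ p? q? f g = ≤-antisym (⟦⟧-mono p? q? f) (⟦⟧-mono q? p? g)

mult-++ : ∀ as bs t → mult (as ++ bs) t ≡ mult as t + mult bs t
mult-++ [] bs t = refl
mult-++ (a ∷ as) bs t = trans (cong (⟦ a ≟ t ⟧ +_) (mult-++ as bs t)) (sym (+-assoc ⟦ a ≟ t ⟧ _ _))

-- For k = n − t, the number of vertices of eccentricity at least t in a path of order n.
M : ℕ → ℕ → ℕ
M t k = k + t ⊓ k

suc-⊓ : ∀ t k → t ⊓ suc k ≡ ⟦ k <? t ⟧ + t ⊓ k
suc-⊓ t k with k <? t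
... | yes k<t = trans (m≥n⇒m⊓n≡n k<t) (cong suc (sym (m≥n⇒m⊓n≡n (<⇒≤ k<t))))
... | no k≮t = trans (m≤n⇒m⊓n≡m (m≤n⇒m≤1+n (≮⇒≥ k≮t))) (sym (m≤n⇒m⊓n≡m (≮⇒≥ k≮t)))

M-suc : ∀ t k → M t (suc k) ≡ suc (⟦ k <? t ⟧ + M t k)
M-suc t k = cong suc (trans (cong (k +_) (suc-⊓ t k)) (shift k ⟦ k <? t ⟧ (t ⊓ k)))
  where
  shift : ∀ a b c → a + (b + c) ≡ b + (a + c)
  shift = solve-∀

count-< : ∀ c m → ∑ (λ i → ⟦ i <? c ⟧) (downFrom m) ≡ c ⊓ m
count-< c zero = sym (⊓-zeroʳ c)
count-< c (suc m) = trans (cong (⟦ m <? c ⟧ +_) (count-< c m)) (sym (suc-⊓ c m))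

-- Adding one vertex

module Stage {n : ℕ} (μ : GraphMetric n) where
  open Metric μ public

  -- Only targets in `S` count, but distances are those of the whole graph; hence the value never
  -- drops as `S` grows.
  eccIn : List V → V → ℕ
  eccIn S y = foldr _⊔_ 0 (map (d y) S)

  d≤eccIn : ∀ {S z} y → z ∈ S → d y z ≤ eccIn S y
  d≤eccIn y (here refl) = m≤m⊔n _ _
  d≤eccIn y (there z∈) = ≤-trans (d≤eccIn y z∈) (m≤n⊔m (d y _) _)

  eccIn-attained : ∀ {t} S y → 1 ≤ t → t ≤ eccIn S y → ∃ λ z → z ∈ S × t ≤ d y z
  eccIn-attained [] y 1≤t t≤ = contradiction (≤-trans 1≤t t≤) λ ()
  eccIn-attained {t} (x ∷ S) y 1≤t t≤ with t ≤? d y x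
  ... | yes le = x , here refl , le
  ... | no ≰ with eccIn-attained S y 1≤t (rest (⊔-sel (d y x) (eccIn S y)))
    where
    rest : _ → t ≤ eccIn S y
    rest (inj₁ e) = contradiction (≤-trans t≤ (≤-reflexive e)) ≰
    rest (inj₂ e) = ≤-trans t≤ (≤-reflexive e)
  ... | z , z∈ , le = z , there z∈ , le

  pairs : ℕ → List V → ℕ
  pairs t [] = 0
  pairs t (x ∷ S) = above (d x) t S + pairs t S

  N : ℕ → List V → ℕ
  N t S = ∑ (λ y → ⟦ t ≤? eccIn S y ⟧) S

  module _ {t : ℕ} (x : V) (S : List V) where

    private
      mono : ∀ {y} → y ∈ S → ⟦ t ≤? eccIn S y ⟧ ≤ ⟦ t ≤? eccIn (x ∷ S) y ⟧
      mono {y} _ = ⟦⟧-mono (t ≤? eccIn S y) (t ≤? eccIn (x ∷ S) y) (λ le → ≤-trans le (m≤n⊔m (d y x) _))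

      x-counts : ∀ {z} → z ∈ S → t ≤ d x z → 1 ≤ ⟦ t ≤? eccIn (x ∷ S) x ⟧
      x-counts z∈ le = ≤-reflexive (sym (⟦⟧-yes (t ≤? eccIn (x ∷ S) x) (≤-trans le (d≤eccIn x (there z∈)))))

    N-mono : N t S ≤ N t (x ∷ S)
    N-mono = ≤-trans (∑-mono S mono) (m≤n+m _ _)

    N-gain₁ : 1 ≤ above (d x) t S → suc (N t S) ≤ N t (x ∷ S)
    N-gain₁ far with ∑-positive (λ y → t ≤? d x y) S far
    ... | z , z∈ , le = +-mono-≤ (x-counts z∈ le) (∑-mono S mono)

    -- `x` and `w` witness each other, and `w` had no witness in `S`; so both are new in the count.
    N-gain₂ : ∀ {w} → 1 ≤ t → w ∈ S → t ≤ d x w → (∀ {y} → y ∈ S → d w y < t) → suc (suc (N t S)) ≤ N t (x ∷ S)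
    N-gain₂ {w} 1≤t w∈ le iso = +-mono-≤ (x-counts w∈ le) (∑-mono-< S mono w∈
      (≤-trans (s≤s (≤-reflexive (⟦⟧-no (t ≤? eccIn S w) isolated)))
        (≤-reflexive (sym (⟦⟧-yes (t ≤? eccIn (x ∷ S) w)
          (≤-trans le (≤-trans (≤-reflexive (d-sym x w)) (d≤eccIn {x ∷ S} w (here refl)))))))))
      where
      isolated : ¬ (t ≤ eccIn S w)
      isolated t≤ with eccIn-attained S w 1≤t t≤
      ... | z , z∈ , t≤z = contradiction (iso z∈) (≤⇒≯ t≤z)

  -- The increment of `Bound` under one added vertex, with `g` new credits and `l` new debts. For
  -- the path, `tri` grows by `k + 1` and `M t` by `1 + ⟦ k <? t ⟧`; the two ones are cancelled and
  -- all subtractions moved across.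
  record Step (t k g l : ℕ) (x : V) (S : List V) : Set where
    constructor mk-step
    field holds : above (d x) t S + ⟦ k <? t ⟧ + g + N t S ≤ k + N t (x ∷ S) + l

  -- For |S| = t + k: compared with a path of the same order, S has δ credits and ℓ debts at threshold t.
  record Bound (t k δ ℓ : ℕ) (S : List V) : Set where
    constructor mk-bound
    field holds : pairs t S + M t k + δ ≤ tri k + N t S + ℓ

  bound-step : ∀ {t k g l δ ℓ x S} → Step t k g l x S → Bound t k δ ℓ S → Bound t (suc k) (g + δ) (l + ℓ) (x ∷ S)
  bound-step {t} {k} {g} {l} {δ} {ℓ} {x} {S} (mk-step st) (mk-bound bd) = mk-bound (+-cancelʳ-≤ (N t S) _ _ (begin
    a + p + M t (suc k) + (g + δ) + N t S       ≡⟨ cong (λ z → a + p + z + (g + δ) + N t S) (M-suc t k) ⟩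
    a + p + suc (b + M t k) + (g + δ) + N t S   ≡⟨ shuffle₁ a p b (M t k) g δ (N t S) ⟩
    suc ((a + b + g + N t S) + (p + M t k + δ)) ≤⟨ s≤s (+-mono-≤ st bd) ⟩
    suc ((k + N t (x ∷ S) + l) + (tri k + N t S + ℓ)) ≡⟨ shuffle₂ k (N t (x ∷ S)) l (tri k) (N t S) ℓ ⟩
    suc k + tri k + N t (x ∷ S) + (l + ℓ) + N t S ∎))
    where
    open ≤-Reasoning
    a = above (d x) t S
    p = pairs t S
    b = ⟦ k <? t ⟧
    shuffle₁ : ∀ a p b m g δ q → a + p + suc (b + m) + (g + δ) + q ≡ suc ((a + b + g + q) + (p + m + δ))
    shuffle₁ = solve-∀
    shuffle₂ : ∀ k N′ l r q ℓ → suc ((k + N′ + l) + (r + q + ℓ)) ≡ suc k + r + N′ + (l + ℓ) + q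
    shuffle₂ = solve-∀

  module _ {S : List V} {x : V} (conn : Conn S) (x∉S : x ∉ S) {a : V} (a∈S : a ∈ S) (xa : d x a ≡ 1)
    {t′ k : ℕ} (1≤k : 1 ≤ k) (len : length S ≡ suc t′ + k) where

    private
      t deg b : ℕ
      t = suc t′
      deg = above (d x) t S
      b = ⟦ k <? t ⟧

      no-far : ∀ {g l} → ¬ (1 ≤ deg) → b + g ≤ k + l → Step t k g l x S
      no-far {g} {l} none le = mk-step (begin
        deg + b + g + N t S   ≡⟨ cong (λ z → z + b + g + N t S) (n<1⇒n≡0 (≰⇒> none)) ⟩
        b + g + N t S         ≤⟨ +-mono-≤ le (N-mono x S) ⟩
        k + l + N t (x ∷ S)   ≡⟨ swap k l (N t (x ∷ S)) ⟩
        k + N t (x ∷ S) + l   ∎)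
        where
        open ≤-Reasoning
        swap : ∀ a b c → a + b + c ≡ a + c + b
        swap = solve-∀

      some-far : ∀ {g l} j → deg + b + g ≤ k + j + l → j + N t S ≤ N t (x ∷ S) → Step t k g l x S
      some-far {g} {l} j le gain = mk-step (begin
        deg + b + g + N t S   ≤⟨ +-monoˡ-≤ (N t S) le ⟩
        k + j + l + N t S     ≡⟨ swap k j l (N t S) ⟩
        k + (j + N t S) + l   ≤⟨ +-monoˡ-≤ l (+-monoʳ-≤ k gain) ⟩
        k + N t (x ∷ S) + l   ∎)
        where
        open ≤-Reasoning
        swap : ∀ a b c e → a + b + c + e ≡ a + (b + e) + c
        swap = solve-∀

      deg≤ : 1 ≤ deg → deg ≤ suc k
      deg≤ far = ≤-trans (≤-reflexive (sym (+-identityʳ deg)))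
        (degree-bound conn x∉S a∈S xa t′ k [] len far [] [] [])

    -- If nothing is far from `x`, then `k` absorbs the charge. Otherwise `x` itself joins the count
    -- `N`, and each doubled level lowers the degree by one, which pays for `⟦ k <? t ⟧` and the
    -- credits.
    step-gain : ∀ {g} rs → Unique rs → All (λ r → 1 ≤ r × r ≤ t′) rs → All (λ r → 2 ≤ level (d x) r S) rs →
      b + g ≤ k → b + g ≤ length rs → Step t k g 0 x S
    step-gain {g} rs uq rs-in dbl ≤k ≤rs with 1 ≤? deg
    ... | no none = no-far none (≤-trans ≤k (≤-reflexive (sym (+-identityʳ k))))
    ... | yes far = some-far 1 (begin
        deg + b + g      ≡⟨ +-assoc deg b g ⟩
        deg + (b + g)    ≤⟨ +-monoʳ-≤ deg ≤rs ⟩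
        deg + length rs  ≤⟨ degree-bound conn x∉S a∈S xa t′ k rs len far uq rs-in dbl ⟩
        suc k            ≡⟨ shift k ⟩
        k + 1 + 0        ∎) (N-gain₁ x S far)
      where
      open ≤-Reasoning
      shift : ∀ k → suc k ≡ k + 1 + 0
      shift = solve-∀

    -- Meant for `t = 2`, `k = 1`: a vertex attached to the middle of a path of order 3 makes two
    -- new far pairs but only one new vertex of eccentricity 2, and misses the plain step by one.
    step-weak : Step t k 0 1 x S
    step-weak with 1 ≤? deg
    ... | no none = no-far none (+-mono-≤ (≤-trans (⟦⟧≤1 (k <? t)) 1≤k) z≤n)
    ... | yes far = some-far 1 (begin
        deg + b + 0   ≤⟨ +-monoˡ-≤ 0 (+-mono-≤ (deg≤ far) (⟦⟧≤1 (k <? t))) ⟩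
        suc k + 1 + 0 ≡⟨ shift k ⟩
        k + 1 + 1     ∎) (N-gain₁ x S far)
      where
      open ≤-Reasoning
      shift : ∀ k → suc k + 1 + 0 ≡ k + 1 + 1
      shift = solve-∀

    -- The only delicate case is `k < t` with the maximal degree `k + 1`; there
    -- `isolated-far-vertex` supplies a second vertex that newly acquires eccentricity `t`.
    step-plain : t ≤ k ⊎ 3 ≤ t → Step t k 0 0 x S
    step-plain hyp = by-cases (1 ≤? deg) (k <? t) (deg ≤? k)
      where
      shift₁ : ∀ k → suc k ≡ k + 1 + 0
      shift₁ = solve-∀
      shift₂ : ∀ k → suc k + 1 + 0 ≡ k + 2 + 0
      shift₂ = solve-∀
      gain : deg ≡ suc k → k < t → t ≤ k ⊎ 3 ≤ t → 2 + N t S ≤ N t (x ∷ S)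
      gain sat k<t (inj₁ t≤k) = contradiction k<t (≤⇒≯ t≤k)
      gain sat k<t (inj₂ (s≤s (s≤s (s≤s {n = c} z≤n))))
        with Saturated.isolated-far-vertex (suc c) k conn x∉S a∈S xa len sat k<t (s≤s (s≤s (s≤s z≤n)))
      ... | z , z∈ , le , iso = N-gain₂ x S (s≤s z≤n) z∈ le iso
      by-cases : Dec (1 ≤ deg) → Dec (k < t) → Dec (deg ≤ k) → Step t k 0 0 x S
      by-cases (no none) _ _ = no-far none (+-mono-≤ (≤-trans (⟦⟧≤1 (k <? t)) 1≤k) z≤n)
      by-cases (yes far) (no k≮t) _ = some-far 1 (≤-trans
        (≤-reflexive (trans (cong (λ z → deg + z + 0) (⟦⟧-no (k <? t) k≮t))
          (trans (+-identityʳ _) (+-identityʳ _))))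
        (≤-trans (deg≤ far) (≤-reflexive (shift₁ k)))) (N-gain₁ x S far)
      by-cases (yes far) (yes _) (yes deg≤k) = some-far 1
        (+-monoˡ-≤ 0 (+-mono-≤ deg≤k (⟦⟧≤1 (k <? t)))) (N-gain₁ x S far)
      by-cases (yes far) (yes k<t) (no deg≰k) = some-far 2
        (≤-trans (+-monoˡ-≤ 0 (+-mono-≤ (deg≤ far) (⟦⟧≤1 (k <? t)))) (≤-reflexive (shift₂ k)))
        (gain (≤-antisym (deg≤ far) (≰⇒> deg≰k)) k<t hyp)

-- Lists of distinct vertices; splitting and reversing sums

∑-map : ∀ {A B : Set} (f : B → ℕ) (g : A → B) xs → ∑ f (map g xs) ≡ ∑ (f ∘ g) xs
∑-map f g [] = refl
∑-map f g (x ∷ xs) = cong (f (g x) +_) (∑-map f g xs)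

unique⇒length≤ : ∀ {n} {S : List (Fin n)} → Unique S → length S ≤ n
unique⇒length≤ {n} {S} uq = Fin.injective⇒≤ {f = lookup S} (injective uq)
  where
  injective : ∀ {S : List (Fin n)} → Unique S → ∀ {i j} → lookup S i ≡ lookup S j → i ≡ j
  injective (_ ∷ _) {Fin.zero} {Fin.zero} e = refl
  injective {S} (x∉ ∷ _) {Fin.zero} {Fin.suc j} e = contradiction e (All.lookup x∉ (∈-lookup j))
  injective {S} (x∉ ∷ _) {Fin.suc i} {Fin.zero} e = contradiction (sym e) (All.lookup x∉ (∈-lookup i))
  injective (_ ∷ uq) {Fin.suc i} {Fin.suc j} e = cong Fin.suc (injective uq e)

∃∉ : ∀ {n} (S : List (Fin n)) → length S < n → ∃ λ x → x ∉ S
∃∉ {n} S lt = Fin.¬∀⟶∃¬ n (_∈ S) (λ x → _∈?_ Fin._≟_ x S) λ all →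
  contradiction lt (≤⇒≯ (Fin.injective⇒≤ {f = λ x → Any.index (all x)} λ {x} {y} e →
    trans (lookup-index (all x)) (trans (cong (lookup S) e) (sym (lookup-index (all y))))))

∉⇒unique : ∀ {n} {x : Fin n} {S} → x ∉ S → Unique S → Unique (x ∷ S)
∉⇒unique x∉ uq = ¬Any⇒All¬ _ x∉ ∷ uq

full⇒∈ : ∀ {n} {S : List (Fin n)} → Unique S → length S ≡ n → ∀ x → x ∈ S
full⇒∈ {S = S} uq len x with _∈?_ Fin._≟_ x S
... | yes x∈ = x∈
... | no x∉ = contradiction (unique⇒length≤ (∉⇒unique x∉ uq)) (<⇒≱ (s≤s (≤-reflexive (sym len))))

∑₁-split : ∀ m D f → ∑₁ (m + D) f ≡ ∑₁ m (λ i → f (i + D)) + ∑₁ D f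
∑₁-split zero D f = refl
∑₁-split (suc m) D f = trans (cong (f (suc m + D) +_) (∑₁-split m D f)) (sym (+-assoc (f (suc m + D)) _ _))

∑₁-first : ∀ m f → ∑₁ (suc m) f ≡ f 1 + ∑₁ m (f ∘ suc)
∑₁-first zero f = refl
∑₁-first (suc m) f = trans (cong (f (suc (suc m)) +_) (∑₁-first m f)) (swap (f (suc (suc m))) (f 1) _)
  where
  swap : ∀ a b c → a + (b + c) ≡ b + (a + c)
  swap = solve-∀

∑₁-reverse : ∀ m h → ∑₁ m (λ i → h (suc m ∸ i)) ≡ ∑₁ m h
∑₁-reverse zero h = refl
∑₁-reverse (suc m) h = trans (∑₁-first m (λ i → h (suc (suc m) ∸ i))) (cong (h (suc m) +_) (∑₁-reverse m h))

-- Geodesics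

module Geodesic {n : ℕ} (μ : GraphMetric n) (D : ℕ) (v : ℕ → Fin n)
  (geo : ∀ {i j} → i ≤ D → j ≤ D → GraphMetric.d μ (v i) (v j) ≡ ∣ i - j ∣) where
  open Stage μ public

  initial : ℕ → List V
  initial s = map v (downFrom s)

  P : List V
  P = initial (suc D)

  length-P : length P ≡ suc D
  length-P = trans (length-map v (downFrom (suc D))) (length-downFrom (suc D))

  v∈P : ∀ {i} → i ≤ D → v i ∈ P
  v∈P i≤ = ∈-map⁺ v (∈-downFrom⁺ (s≤s i≤))

  ∈P⇒ : ∀ {y} → y ∈ P → ∃ λ i → i ≤ D × y ≡ v i
  ∈P⇒ y∈ with ∈-map⁻ v y∈
  ... | i , i∈ , e = i , ≤-pred (∈-downFrom⁻ i∈) , e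

  v-injective : ∀ {i j} → i ≤ D → j ≤ D → v i ≡ v j → i ≡ j
  v-injective {i} {j} i≤ j≤ e = ∣m-n∣≡0⇒m≡n (trans (sym (geo i≤ j≤)) (trans (cong (d (v i)) (sym e)) (d-refl (v i))))

  P-connected : Conn P
  P-connected = go D ≤-refl
    where
    go : ∀ s → s ≤ D → Conn (initial (suc s))
    go zero _ = single (v 0)
    go (suc s) s<D = extend (v (suc s)) (here refl)
      (trans (geo s<D (<⇒≤ s<D)) (trans (m≤n⇒∣n-m∣≡n∸m (n≤1+n s)) (m+n∸n≡m 1 s))) (go s (<⇒≤ s<D))

  P-unique : Unique P
  P-unique = go (suc D) ≤-refl
    where
    fresh : ∀ s {m} → s ≤ m → m ≤ D → All (v m ≢_) (initial s)
    fresh zero _ _ = []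
    fresh (suc s) {m} s<m m≤ = (λ e → <-irrefl (sym (v-injective m≤ (≤-trans (<⇒≤ s<m) m≤) e)) s<m) ∷ fresh s (<⇒≤ s<m) m≤
    go : ∀ s → s ≤ suc D → Unique (initial s)
    go zero _ = []
    go (suc s) s≤ = fresh s ≤-refl (≤-pred s≤) ∷ go s (<⇒≤ s≤)

  path-degree : ∀ t s → s ≤ D → above (d (v s)) (suc t) (initial s) ≡ s ∸ t
  path-degree t s s≤D = begin
    above (d (v s)) (suc t) (initial s)             ≡⟨ ∑-map _ v (downFrom s) ⟩
    ∑ (λ i → ⟦ suc t ≤? d (v s) (v i) ⟧) (downFrom s) ≡⟨ ∑-cong (downFrom s) (λ {i} i∈ → pointwise i (∈-downFrom⁻ i∈)) ⟩
    ∑ (λ i → ⟦ i <? s ∸ t ⟧) (downFrom s)           ≡⟨ count-< (s ∸ t) s ⟩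
    (s ∸ t) ⊓ s                                     ≡⟨ m≤n⇒m⊓n≡m (m∸n≤m s t) ⟩
    s ∸ t                                           ∎
    where
    open ≡-Reasoning
    swap< : ∀ a b → a < s ∸ b → b < s ∸ a
    swap< a b lt = m+n≤o⇒m≤o∸n (suc b) (≤-trans (≤-reflexive (cong suc (+-comm b a))) (≤-trans (+-monoˡ-≤ b lt)
      (≤-reflexive (m∸n+n≡m (<⇒≤ (m∸n≢0⇒n<m {s} {b} (m<n⇒n≢0 lt)))))))
    pointwise : ∀ i → i < s → ⟦ suc t ≤? d (v s) (v i) ⟧ ≡ ⟦ i <? s ∸ t ⟧
    pointwise i i<s = ⟦⟧-⇔ (suc t ≤? d (v s) (v i)) (i <? s ∸ t)
      (λ le → swap< t i (≤-trans le (≤-reflexive v-dist)))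
      (λ lt → ≤-trans (swap< i t lt) (≤-reflexive (sym v-dist)))
      where
      v-dist : d (v s) (v i) ≡ s ∸ i
      v-dist = trans (geo s≤D (≤-trans (<⇒≤ i<s) s≤D)) (m≤n⇒∣n-m∣≡n∸m (<⇒≤ i<s))

  path-pairs : ∀ t k → suc D ≡ suc t + k → pairs (suc t) P ≡ tri k
  path-pairs t k e = trans (go (suc D) ≤-refl) (cong tri (trans (cong (_∸ suc t) e) (m+n∸m≡n (suc t) k)))
    where
    tri-∸ : ∀ s t → (s ∸ t) + tri (s ∸ suc t) ≡ tri (s ∸ t)
    tri-∸ zero zero = refl
    tri-∸ zero (suc t) = refl
    tri-∸ (suc s) zero = refl
    tri-∸ (suc s) (suc t) = tri-∸ s t
    go : ∀ s → s ≤ suc D → pairs (suc t) (initial s) ≡ tri (s ∸ suc t)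
    go zero _ = refl
    go (suc s) s≤ = trans (cong₂ _+_ (path-degree t s (≤-pred s≤)) (go s (<⇒≤ s≤))) (tri-∸ s t)

  path-ecc : ∀ {t i} → 1 ≤ t → i ≤ D → t ≤ eccIn P (v i) → t ≤ i ⊎ t + i ≤ D
  path-ecc {t} {i} 1≤t i≤ le with eccIn-attained P (v i) 1≤t le
  ... | z , z∈ , t≤ with ∈P⇒ z∈
  ... | j , j≤ , refl with ≤-total j i
  ... | inj₁ j≤i = inj₁ (≤-trans t≤ (≤-trans (≤-reflexive (trans (geo i≤ j≤) (m≤n⇒∣n-m∣≡n∸m j≤i))) (m∸n≤m i j)))
  ... | inj₂ i≤j = inj₂ (≤-trans (+-monoˡ-≤ i (≤-trans t≤ (≤-reflexive (trans (geo i≤ j≤) (m≤n⇒∣m-n∣≡n∸m i≤j)))))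
    (≤-trans (≤-reflexive (m∸n+n≡m i≤j)) j≤))

  -- `v i` is far from `v 0` if `t ≤ i`, and far from `v D` if `i < k`. So all `i ≥ t` count, and of
  -- the `i < t` exactly the min(t, k) smallest; adding `⟦ i <? t ⟧` to both sides avoids
  -- subtraction.
  path-N : ∀ t k → 1 ≤ t → suc D ≡ t + k → N t P ≡ M t k
  path-N t k 1≤t e = +-cancelʳ-≡ t _ _ (begin
    N t P + t                                       ≡⟨ cong₂ _+_ (∑-map _ v (downFrom (suc D))) (sym t-count) ⟩
    ∑ (λ i → ⟦ E i ⟧) Ds + ∑ (λ i → ⟦ i <? t ⟧) Ds   ≡⟨ sym (∑-+ (λ i → ⟦ E i ⟧) (λ i → ⟦ i <? t ⟧) Ds) ⟩
    ∑ (λ i → ⟦ E i ⟧ + ⟦ i <? t ⟧) Ds                ≡⟨ ∑-cong Ds (λ i∈ → pointwise (≤-pred (∈-downFrom⁻ i∈))) ⟩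
    ∑ (λ i → 1 + ⟦ i <? t ⊓ k ⟧) Ds                  ≡⟨ ∑-+ (λ _ → 1) (λ i → ⟦ i <? t ⊓ k ⟧) Ds ⟩
    ∑ (λ _ → 1) Ds + ∑ (λ i → ⟦ i <? t ⊓ k ⟧) Ds     ≡⟨ cong₂ _+_ (trans (∑-one Ds) (trans (length-downFrom (suc D)) e)) tk-count ⟩
    t + k + t ⊓ k                                   ≡⟨ shift t k (t ⊓ k) ⟩
    M t k + t                                       ∎)
    where
    open ≡-Reasoning
    Ds = downFrom (suc D)
    E : ∀ i → Dec (t ≤ eccIn P (v i))
    E i = t ≤? eccIn P (v i)
    shift : ∀ a b c → a + b + c ≡ b + c + a
    shift = solve-∀
    t-count : ∑ (λ i → ⟦ i <? t ⟧) Ds ≡ t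
    t-count = trans (count-< t (suc D)) (m≤n⇒m⊓n≡m (≤-trans (m≤m+n t k) (≤-reflexive (sym e))))
    tk-count : ∑ (λ i → ⟦ i <? t ⊓ k ⟧) Ds ≡ t ⊓ k
    tk-count = trans (count-< (t ⊓ k) (suc D))
      (m≤n⇒m⊓n≡m (≤-trans (m⊓n≤m t k) (≤-trans (m≤m+n t k) (≤-reflexive (sym e)))))
    reach₀ : ∀ {i} → i ≤ D → t ≤ i → t ≤ eccIn P (v i)
    reach₀ {i} i≤ le = ≤-trans le (≤-trans (≤-reflexive (sym (trans (geo i≤ z≤n) (∣-∣-identityʳ i)))) (d≤eccIn (v i) (v∈P z≤n)))
    reachD : ∀ {i} → i ≤ D → i < k → t ≤ eccIn P (v i)
    reachD {i} i≤ i<k = ≤-trans (m+n≤o⇒m≤o∸n t (≤-pred (≤-trans (≤-reflexive (sym (+-suc t i))) (≤-trans (+-monoʳ-≤ t i<k) (≤-reflexive (sym e))))))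
      (≤-trans (≤-reflexive (sym (trans (geo i≤ ≤-refl) (m≤n⇒∣m-n∣≡n∸m i≤)))) (d≤eccIn (v i) (v∈P ≤-refl)))
    pointwise : ∀ {i} → i ≤ D → ⟦ E i ⟧ + ⟦ i <? t ⟧ ≡ 1 + ⟦ i <? t ⊓ k ⟧
    pointwise {i} i≤ with i <? t | i <? k
    ... | no i≮t | _ = trans (cong (_+ 0) (⟦⟧-yes (E i) (reach₀ i≤ (≮⇒≥ i≮t))))
      (cong suc (sym (⟦⟧-no (i <? t ⊓ k) (λ lt → i≮t (≤-trans lt (m⊓n≤m t k))))))
    ... | yes i<t | yes i<k = trans (cong (_+ 1) (⟦⟧-yes (E i) (reachD i≤ i<k)))
      (cong suc (sym (⟦⟧-yes (i <? t ⊓ k) (⊓-pres-m< i<t i<k))))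
    ... | yes i<t | no i≮k = trans (cong (_+ 1) (⟦⟧-no (E i) (not-far (≮⇒≥ i≮k))))
      (cong suc (sym (⟦⟧-no (i <? t ⊓ k) (λ lt → i≮k (≤-trans lt (m⊓n≤n t k))))))
      where
      not-far : k ≤ i → ¬ (t ≤ eccIn P (v i))
      not-far k≤i le with path-ecc 1≤t i≤ le
      ... | inj₁ t≤i = contradiction i<t (≤⇒≯ t≤i)
      ... | inj₂ t+i≤ = 1+n≰n (≤-trans (≤-reflexive e) (≤-trans (+-monoʳ-≤ t k≤i) t+i≤))

-- Growing a diametral geodesic: credits, leaves and pendant paths

module Diametral {n : ℕ} (μ : GraphMetric n) (D : ℕ) (v : ℕ → Fin n)
  (geo : ∀ {i j} → i ≤ D → j ≤ D → GraphMetric.d μ (v i) (v j) ≡ ∣ i - j ∣)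
  (diam : ∀ x y → GraphMetric.d μ x y ≤ D) where
  open Geodesic μ D v geo public

  record Attached (x : V) (S : List V) : Set where
    field
      conn    : Conn S
      fresh   : x ∉ S
      {anchor} : V
      anchor∈ : anchor ∈ S
      edge    : d x anchor ≡ 1

    conn⁺ : Conn (x ∷ S)
    conn⁺ = extend x anchor∈ edge conn

  -- Walking from an outside vertex towards a vertex of `S` along a geodesic, the last vertex before
  -- entering `S` is attached to it.
  next : ∀ {S} → Conn S → length S < n → ∃ λ x → Attached x S
  next {S} conn lt with ∃∉ S lt
  ... | u , u∉ = go (d u (start conn)) u∉ refl
    where
    start : ∀ {S} → Conn S → V
    start (single v) = v
    start (extend x _ _ _) = x
    start∈ : ∀ {S} (c : Conn S) → start c ∈ S
    start∈ (single v) = here refl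
    start∈ (extend x _ _ _) = here refl
    go : ∀ r {u} → u ∉ S → d u (start conn) ≡ r → ∃ λ x → Attached x S
    go zero u∉ e = contradiction (subst (_∈ S) (sym (d≡0⇒≡ e)) (start∈ conn)) u∉
    go (suc r) {u} u∉ e with step e
    ... | w , uw , e′ with _∈?_ Fin._≟_ w S
    ... | yes w∈ = u , record { conn = conn ; fresh = u∉ ; anchor∈ = w∈ ; edge = uw }
    ... | no w∉ = go r w∉ e′

  -- `as` collects the credited and `ls` the indebted thresholds. Thresholds above `D` are left to
  -- `compare`: there G has no far pairs at all.
  record Bounds (S : List V) (as ls : List ℕ) : Set where
    constructor mk-bounds
    field at : ∀ t → 1 ≤ t → t ≤ D → ∀ k → length S ≡ t + k → Bound t k (mult as t) (mult ls t) S

  P-bounds : Bounds P [] []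
  P-bounds = mk-bounds λ { (suc t) 1≤t t≤D k len → let e = trans (sym length-P) len in
    mk-bound (≤-reflexive (cong (_+ 0) (cong₂ _+_ (path-pairs t k e) (sym (path-N (suc t) k 1≤t e))))) }

  Gain : ℕ → V → List V → Set
  Gain t x S = ∀ k → 1 ≤ k → length S ≡ t + k → Step t k 1 0 x S

  -- The hypothesis of `step-plain` at every threshold, free of `k`: `t + t ≤ length S` says
  -- `t ≤ k`. In this form it persists as `S` grows.
  Roomy : List V → Set
  Roomy S = ∀ t → 1 ≤ t → t ≤ D → 3 ≤ t ⊎ t + t ≤ length S

  shorten : ∀ (S : List V) → suc D ≤ length S → ∀ {t k} → t ≤ D → suc (length S) ≡ t + k →
    ∃ λ k′ → k ≡ suc k′ × 1 ≤ k′ × length S ≡ t + k′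
  shorten S long {t} {zero} t≤D len =
    contradiction (≤-trans (≤-reflexive len) (≤-trans (≤-reflexive (+-identityʳ t)) (≤-trans t≤D (<⇒≤ long)))) 1+n≰n
  shorten S long {t} {suc k} t≤D len = k , refl ,
    +-cancelˡ-≤ t 1 k (≤-trans (≤-reflexive (+-comm t 1)) (≤-trans (s≤s t≤D) (≤-trans long (≤-reflexive len′)))) , len′
    where
    len′ : length S ≡ t + k
    len′ = suc-injective (trans len (+-suc t k))

  bounds-extend : ∀ {x S as ls} → Attached x S → suc D ≤ length S → Roomy S → Bounds S as ls →
    ∀ bs → Unique bs → All (λ b → Gain b x S) bs → Bounds (x ∷ S) (bs ++ as) ls
  bounds-extend {x} {S} {as} {ls} att long room (mk-bounds bd) bs uq gains = mk-bounds at′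
    where
    open Attached att
    at′ : ∀ t → 1 ≤ t → t ≤ D → ∀ k → length (x ∷ S) ≡ t + k → Bound t k (mult (bs ++ as) t) (mult ls t) (x ∷ S)
    at′ (suc t) 1≤t t≤D k len with shorten S long t≤D len
    ... | k′ , refl , 1≤k′ , len′ = subst (λ z → Bound (suc t) (suc k′) z (mult ls (suc t)) (x ∷ S)) (sym (mult-++ bs as (suc t)))
      (bound-step (the-step (mult-unique (suc t) uq)) (bd (suc t) 1≤t t≤D k′ len′))
      where
      room′ : 3 ≤ suc t ⊎ suc t + suc t ≤ length S → suc t ≤ k′ ⊎ 3 ≤ suc t
      room′ (inj₁ 3≤) = inj₂ 3≤
      room′ (inj₂ le) = inj₁ (+-cancelˡ-≤ (suc t) _ _ (≤-trans le (≤-reflexive len′)))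
      the-step : mult bs (suc t) ≡ 0 ⊎ (mult bs (suc t) ≡ 1 × suc t ∈ bs) → Step (suc t) k′ (mult bs (suc t)) 0 x S
      the-step (inj₁ e) = subst (λ g → Step (suc t) k′ g 0 x S) (sym e)
        (step-plain conn fresh anchor∈ edge 1≤k′ len′ (room′ (room (suc t) 1≤t t≤D)))
      the-step (inj₂ (e , t∈)) = subst (λ g → Step (suc t) k′ g 0 x S) (sym e) (All.lookup gains t∈ k′ 1≤k′ len′)

  -- Here `P` has three vertices, too few for a plain step at `t = 2`. After this single debt there
  -- are four vertices and all later steps are plain.
  bounds-extend-weak : D ≡ 2 → ∀ {x} → Attached x P → Bounds (x ∷ P) [] (2 ∷ [])
  bounds-extend-weak D≡2 {x} att = mk-bounds λ t 1≤t t≤D k len → at′ t 1≤t t≤D k (shorten P (≤-reflexive (sym length-P)) t≤D len)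
    where
    open Attached att
    go : ∀ k′ → 1 ≤ k′ → ∀ t → 1 ≤ t → t ≤ 2 → Bound t k′ 0 0 P → length P ≡ t + k′ → Bound t (suc k′) 0 (mult (2 ∷ []) t) (x ∷ P)
    go k′ 1≤k′ 1 _ _ bd len = bound-step {l = 0} (step-plain conn fresh anchor∈ edge 1≤k′ len (inj₁ 1≤k′)) bd
    go k′ 1≤k′ 2 _ _ bd len = bound-step {l = 1} (step-weak conn fresh anchor∈ edge 1≤k′ len) bd
    go k′ 1≤k′ (suc (suc (suc t))) _ (s≤s (s≤s ())) bd len
    at′ : ∀ t → 1 ≤ t → t ≤ D → ∀ k → (∃ λ k′ → k ≡ suc k′ × 1 ≤ k′ × length P ≡ t + k′) → Bound t k 0 (mult (2 ∷ []) t) (x ∷ P)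
    at′ t 1≤t t≤D k (k′ , refl , 1≤k′ , len′) =
      go k′ 1≤k′ t 1≤t (≤-trans t≤D (≤-reflexive D≡2)) (Bounds.at P-bounds t 1≤t t≤D k′ len′) len′

  bounds-complete : ∀ {S as ls} r → length S + r ≡ n → Conn S → Unique S → suc D ≤ length S → Roomy S → Bounds S as ls →
    ∃ λ L → Unique L × length L ≡ n × Bounds L as ls
  bounds-complete {S} zero len conn uq long room bd = S , uq , trans (sym (+-identityʳ _)) len , bd
  bounds-complete {S} (suc r) len conn uq long room bd
    with next conn (≤-trans (m≤m+n _ r) (≤-reflexive (trans (sym (+-suc (length S) r)) len)))
  ... | x , att = bounds-complete r (trans (sym (+-suc (length S) r)) len) conn⁺ (∉⇒unique fresh uq)
    (m≤n⇒m≤1+n long) room⁺ (bounds-extend att long room bd [] [] [])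
    where
    open Attached att
    room⁺ : Roomy (x ∷ S)
    room⁺ t 1≤t t≤D with room t 1≤t t≤D
    ... | inj₁ le = inj₁ le
    ... | inj₂ le = inj₂ (m≤n⇒m≤1+n le)

  Two : V → List V → ℕ → Set
  Two x S r = ∃₂ λ p q → p ≢ q × p ∈ S × q ∈ S × d x p ≡ r × d x q ≡ r

  two-level : ∀ {x S r} → Two x S r → 2 ≤ level (d x) r S
  two-level (p , q , p≢q , p∈ , q∈ , ep , eq) = level≥2 (d _) p≢q p∈ q∈ ep eq

  -- With at least 2t vertices, `k ≥ t` and the term `⟦ k <? t ⟧` vanishes, so one doubled level is
  -- free to become a credit.
  gain₁ : ∀ {x S t r} → Attached x S → 1 ≤ r → r < t → t + t ≤ length S → Two x S r → Gain t x S
  gain₁ {x} {S} {suc t} {r} att 1≤r r<t room two k 1≤k len =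
    step-gain conn fresh anchor∈ edge 1≤k len (r ∷ []) ([] ∷ []) ((1≤r , ≤-pred r<t) ∷ []) (two-level two ∷ [])
      (≤-trans (≤-reflexive b+1) 1≤k) (≤-reflexive b+1)
    where
    open Attached att
    b+1 : ⟦ k <? suc t ⟧ + 1 ≡ 1
    b+1 = cong (_+ 1) (⟦⟧-no (k <? suc t) (≤⇒≯ (+-cancelˡ-≤ (suc t) _ _ (≤-trans room (≤-reflexive len)))))

  -- One doubled level pays for `⟦ k <? t ⟧`, the other for the credit; `t + 2 ≤ length S` gives
  -- `k ≥ 2`, which covers the case of no far vertex.
  gain₂ : ∀ {x S t r s} → Attached x S → 1 ≤ r → r < s → s < t → t + 2 ≤ length S → Two x S r → Two x S s → Gain t x S
  gain₂ {x} {S} {suc t} {r} {s} att 1≤r r<s s<t room two₁ two₂ k 1≤k len =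
    step-gain conn fresh anchor∈ edge 1≤k len (r ∷ s ∷ []) (((λ { refl → <-irrefl refl r<s }) ∷ []) ∷ [] ∷ [])
      ((1≤r , ≤-trans (<⇒≤ r<s) (≤-pred s<t)) ∷ (≤-trans 1≤r (<⇒≤ r<s) , ≤-pred s<t) ∷ [])
      (two-level two₁ ∷ two-level two₂ ∷ [])
      (≤-trans b+1 (+-cancelˡ-≤ (suc t) _ _ (≤-trans room (≤-reflexive len)))) b+1
    where
    open Attached att
    b+1 : ⟦ k <? suc t ⟧ + 1 ≤ 2
    b+1 = +-monoˡ-≤ 1 (⟦⟧≤1 (k <? suc t))

  -- Geodesics of G between vertices of `S` can be chosen inside `S`. This is what makes a single
  -- neighbour in `S` determine all distances from a leaf (`leaf-dist`).
  Isometric : List V → Set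
  Isometric S = ∀ {x y} → x ∈ S → y ∈ S → x ≢ y → ∃ λ z → z ∈ S × d x z ≡ 1 × d x y ≡ suc (d z y)

  Leaf : V → List V → V → Set
  Leaf x S w = w ∈ S × d x w ≡ 1 × (∀ {z} → z ∈ S → d x z ≡ 1 → z ≡ w)

  leaf-or-two : ∀ {x S a} → a ∈ S → d x a ≡ 1 → Leaf x S a ⊎ Two x S 1
  leaf-or-two {x} {S} {a} a∈ xa with Any.any? (λ z → (d x z ≟ 1) ×-dec ¬? (z Fin.≟ a)) S
  ... | yes found with z , z∈ , (xz , z≢a) ← find found = inj₂ (z , a , z≢a , z∈ , a∈ , xz , xa)
  ... | no none = inj₁ (a∈ , xa , λ {z} z∈ xz → only z z∈ xz)
    where
    only : ∀ z → z ∈ S → d x z ≡ 1 → z ≡ a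
    only z z∈ xz with z Fin.≟ a
    ... | yes e = e
    ... | no z≢a = contradiction (lose z∈ (xz , z≢a)) none

  isometric-full : ∀ {S} → (∀ x → x ∈ S) → Isometric S
  isometric-full all {x} {y} _ _ x≢y with d x y in e
  ... | zero = contradiction (d≡0⇒≡ e) x≢y
  ... | suc r with step e
  ... | z , xz , zy = z , all z , xz , cong suc (sym zy)

  leaf-dist : ∀ {T x w} → Isometric T → x ∈ T → Leaf x T w → ∀ {u} → u ∈ T → u ≢ x → d x u ≡ suc (d w u)
  leaf-dist iso x∈ (w∈ , xw , only) u∈ u≢x with iso x∈ u∈ (u≢x ∘ sym)
  ... | z , z∈ , xz , e with only z∈ xz
  ... | refl = e

  not-self : ∀ {x} → d x x ≢ 1
  not-self {x} e = contradiction (trans (sym (d-refl x)) e) λ ()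

  leaf-∷ : ∀ {x S w} → Leaf x S w → Leaf x (x ∷ S) w
  leaf-∷ {x} {S} {w} (w∈ , xw , only) = there w∈ , xw , only′
    where
    only′ : ∀ {z} → z ∈ x ∷ S → d x z ≡ 1 → z ≡ w
    only′ (here refl) e = contradiction e not-self
    only′ (there z∈) e = only z∈ e

  leaf-dist-∷ : ∀ {x S w} → Isometric (x ∷ S) → x ∉ S → Leaf x S w → ∀ {u} → u ∈ S → d x u ≡ suc (d w u)
  leaf-dist-∷ iso x∉ leaf u∈ = leaf-dist iso (here refl) (leaf-∷ leaf) (there u∈) (λ { refl → x∉ u∈ })

  -- A geodesic from `p` to `q` whose first step is the leaf `x` starts at `p = w`; then `q` is
  -- closer to `x` than to `w`, against `leaf-dist`.
  peel : ∀ {x S w} → Isometric (x ∷ S) → x ∉ S → Leaf x S w → Isometric S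
  peel {x} {S} {w} iso x∉ leaf@(w∈ , xw , only) {p} {q} p∈ q∈ p≢q with iso (there p∈) (there q∈) p≢q
  ... | z , there z∈ , pz , e = z , z∈ , pz , e
  ... | _ , here refl , px , e with only p∈ (dist-flip px)
  ... | refl = contradiction (trans e (cong suc (leaf-dist-∷ iso x∉ leaf q∈))) (<⇒≢ (n≤1+n _))

  -- x hangs on v i by a path of length c.
  Ray : ℕ → V → ℕ → Set
  Ray c x i = i ≤ D × (∀ {j} → j ≤ D → d x (v j) ≡ c + ∣ i - j ∣)

  Pend : ℕ → V → ℕ → Set
  Pend c x i = c ≤ i × i + c ≤ D × Ray c x i

  -- The diameter bound at both ends of the geodesic: c + (D - i) ≤ D for `v D` and c + i ≤ D for
  -- `v 0`, where c is the length of the pendant path. So neither arm at `v i` is shorter than that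
  -- path.
  pend : ∀ {c x y i} → (∀ {j} → j ≤ D → d y (v j) ≡ suc (d x (v j))) → Ray c x i → Pend (suc c) y i
  pend {c} {x} {y} {i} dy (i≤ , ray) =
    +-cancelʳ-≤ (D ∸ i) _ _ (≤-trans (≤-reflexive (sym (trans (dy′ ≤-refl) (cong (suc c +_) (m≤n⇒∣m-n∣≡n∸m i≤)))))
      (≤-trans (diam y (v D)) (≤-reflexive (sym (m+[n∸m]≡n i≤))))) ,
    ≤-trans (≤-reflexive (trans (+-comm i (suc c)) (sym (trans (dy′ z≤n) (cong (suc c +_) (∣-∣-identityʳ i)))))) (diam y (v 0)) ,
    i≤ , dy′
    where
    dy′ : ∀ {j} → j ≤ D → d y (v j) ≡ suc c + ∣ i - j ∣
    dy′ j≤ = trans (dy j≤) (cong suc (ray j≤))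

  -- Both arms reach at least `c` steps from `v i`, and their vertices at step `s` share a level
  -- around `x`.
  pend-two : ∀ {c x i S} → (∀ {u} → u ∈ P → u ∈ S) → Pend c x i → ∀ s → 1 ≤ s → s ≤ c → Two x S (c + s)
  pend-two {c} {x} {i} P⊆S (c≤i , i+c≤ , i≤ , ray) s 1≤s s≤c =
    v (i ∸ s) , v (i + s) , (λ e → <-irrefl (v-injective lo hi e) below<above) , P⊆S (v∈P lo) , P⊆S (v∈P hi) ,
    trans (ray lo) (cong (c +_) (trans (m≤n⇒∣n-m∣≡n∸m (m∸n≤m i s)) (m∸[m∸n]≡n (≤-trans s≤c c≤i)))) ,
    trans (ray hi) (cong (c +_) (∣m-m+n∣≡n i s))
    where
    lo : i ∸ s ≤ D
    lo = ≤-trans (m∸n≤m i s) i≤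
    hi : i + s ≤ D
    hi = ≤-trans (+-monoʳ-≤ i s≤c) i+c≤
    below<above : i ∸ s < i + s
    below<above = ≤-trans (s≤s (m∸n≤m i s)) (≤-trans (≤-reflexive (+-comm 1 i)) (+-monoʳ-≤ i 1≤s))

  two-lift : ∀ {w z Q S r} → (∀ {u} → u ∈ Q → u ∈ S) → (∀ {u} → u ∈ S → d z u ≡ suc (d w u)) → Two w Q r → Two z S (suc r)
  two-lift Q⊆S dz (p , q , p≢q , p∈ , q∈ , ep , eq) =
    p , q , p≢q , Q⊆S p∈ , Q⊆S q∈ , trans (dz (Q⊆S p∈)) (cong suc ep) , trans (dz (Q⊆S q∈)) (cong suc eq)

  pend-on-P : ∀ {y w} → w ∈ P → (∀ {u} → u ∈ P → d y u ≡ suc (d w u)) → ∃ (Pend 1 y)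
  pend-on-P w∈ dy with ∈P⇒ w∈
  ... | i , i≤ , refl = i , pend (λ j≤ → dy (v∈P j≤)) (i≤ , geo i≤)

-- At most four vertices off the geodesic

module Cases {n : ℕ} (μ : GraphMetric n) (D : ℕ) (v : ℕ → Fin n)
  (geo : ∀ {i j} → i ≤ D → j ≤ D → GraphMetric.d μ (v i) (v j) ≡ ∣ i - j ∣)
  (diam : ∀ x y → GraphMetric.d μ x y ≤ D) where
  open Diametral μ D v geo diam public

  In-range : ℕ → Set
  In-range t = 1 ≤ t × t ≤ D

  Progress : List V → List ℕ → Set
  Progress S as = Bounds S as [] × All In-range as

  -- `q` is one more than the value lost at thresholds above `D`: 2, 3, 3, 1 for one to four
  -- vertices off the geodesic.
  record Outcome (q : ℕ) : Set where
    constructor outcome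
    field
      {order}   : List V
      {credits} : List ℕ
      unique    : Unique order
      spanning  : length order ≡ n
      progress  : Progress order credits
      enough    : q ≤ length credits

  P-progress : Progress P []
  P-progress = P-bounds , []

  roomy : ∀ {S} → 3 ≤ D → suc D ≤ length S → Roomy S
  roomy 3≤D long 1 _ _ = inj₂ (≤-trans (s≤s (≤-trans (s≤s z≤n) 3≤D)) long)
  roomy 3≤D long 2 _ _ = inj₂ (≤-trans (s≤s 3≤D) long)
  roomy 3≤D long (suc (suc (suc t))) _ _ = inj₁ (s≤s (s≤s (s≤s z≤n)))

  Credit : V → List V → ℕ → Set
  Credit x S t = In-range t × Gain t x S

  module Order (3≤D : 3 ≤ D) where

    add : ∀ {x S as} → Attached x S → suc D ≤ length S → Progress S as →
      ∀ bs {_ : True (unique? bs)} → All (Credit x S) bs → Progress (x ∷ S) (bs ++ as)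
    add {S = S} att long (bd , range) bs {u} credits =
      bounds-extend att long (roomy {S} 3≤D long) bd bs (toWitness u) (All.map proj₂ credits) ,
      ++⁺ (All.map proj₁ credits) range

  module _ {x : V} {S : List V} (att : Attached x S) {c e : ℕ} (c≤D : c ≤ D) (e≤S : e ≤ length S) where

    credit₁ : ∀ t r {_ : T (1 ≤ᵇ r)} {_ : T (r <ᵇ t)} {_ : T (t ≤ᵇ c)} {_ : T (t + t ≤ᵇ e)} → Two x S r → Credit x S t
    credit₁ t r {p₁} {p₂} {p₃} {p₄} two =
      (≤-trans 1≤r (<⇒≤ (<ᵇ⇒< r t p₂)) , ≤-trans (≤ᵇ⇒≤ t c p₃) c≤D) ,
      gain₁ att 1≤r (<ᵇ⇒< r t p₂) (≤-trans (≤ᵇ⇒≤ (t + t) e p₄) e≤S) two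
      where
      1≤r : 1 ≤ r
      1≤r = ≤ᵇ⇒≤ 1 r p₁

    credit₂ : ∀ t r s {_ : T (1 ≤ᵇ r)} {_ : T (r <ᵇ s)} {_ : T (s <ᵇ t)} {_ : T (t ≤ᵇ c)} {_ : T (t + 2 ≤ᵇ e)} →
      Two x S r → Two x S s → Credit x S t
    credit₂ t r s {p₁} {p₂} {p₃} {p₄} {p₅} two₁ two₂ =
      (≤-trans 1≤r (<⇒≤ (<-trans (<ᵇ⇒< r s p₂) (<ᵇ⇒< s t p₃))) , ≤-trans (≤ᵇ⇒≤ t c p₄) c≤D) ,
      gain₂ att 1≤r (<ᵇ⇒< r s p₂) (<ᵇ⇒< s t p₃) (≤-trans (≤ᵇ⇒≤ (t + 2) e p₅) e≤S) two₁ two₂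
      where
      1≤r : 1 ≤ r
      1≤r = ≤ᵇ⇒≤ 1 r p₁

  neighbours : ∀ {x S} → Attached x S → (∃ λ w → Leaf x S w) ⊎ Two x S 1
  neighbours att with leaf-or-two (Attached.anchor∈ att) (Attached.edge att)
  ... | inj₁ leaf = inj₁ (_ , leaf)
  ... | inj₂ two = inj₂ two

  pend₁-two : ∀ {x S} → (∀ {u} → u ∈ P → u ∈ S) → ∃ (Pend 1 x) → Two x S 2
  pend₁-two P⊆S (i , pd) = pend-two P⊆S pd 1 ≤-refl ≤-refl

  pend₂-two : ∀ {x S i} → (∀ {u} → u ∈ P → u ∈ S) → Pend 2 x i → Two x S 3
  pend₂-two P⊆S pd = pend-two P⊆S pd 1 ≤-refl (s≤s z≤n)

  pend-pend : ∀ {c x y i} → (∀ {u} → u ∈ P → d y u ≡ suc (d x u)) → Pend c x i → Pend (suc c) y i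
  pend-pend dy (_ , _ , ray) = pend (λ j≤ → dy (v∈P j≤)) ray

  pend₃-long : ∀ {x i} → Pend 3 x i → 6 ≤ D
  pend₃-long (3≤i , i+3≤D , _) = ≤-trans (+-monoˡ-≤ 3 3≤i) i+3≤D

  -- z and y are pendant at x, which is pendant at v i: z sees both y and v i at distance 2.
  fork-two : ∀ {x y z i S} → (∀ {u} → u ∈ S → d z u ≡ suc (d x u)) → y ∉ P → y ∈ S → (∀ {u} → u ∈ P → u ∈ S) →
    d y x ≡ 1 → Pend 1 x i → Two z S 2
  fork-two {i = i} dz y∉ y∈ P⊆S yx (_ , _ , i≤ , ray) =
    _ , v i , (λ { refl → y∉ (v∈P i≤) }) , y∈ , P⊆S (v∈P i≤) ,
    trans (dz y∈) (cong suc (dist-flip yx)) ,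
    trans (dz (P⊆S (v∈P i≤))) (cong suc (trans (ray i≤) (cong suc (∣n-n∣≡0 i))))

  P-long : suc D ≤ length P
  P-long = ≤-reflexive (sym length-P)

  off₁ : 7 ≤ D → suc (suc D) ≡ n → Outcome 2
  off₁ 7≤D size with next P-connected (≤-reflexive (trans (cong suc length-P) size))
  ... | x , ax = outcome (∉⇒unique fresh P-unique) span
      (add ax P-long P-progress (3 ∷ 4 ∷ []) (credits (neighbours ax))) ≤-refl
    where
    open Order (≤-trans (≤ᵇ⇒≤ 3 7 _) 7≤D)
    open Attached ax
    span : suc (length P) ≡ n
    span = trans (cong suc length-P) size
    iso : Isometric (x ∷ P)
    iso = isometric-full (full⇒∈ (∉⇒unique fresh P-unique) span)
    8≤P : 8 ≤ length P
    8≤P = ≤-trans (s≤s 7≤D) P-long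
    credits : (∃ λ w → Leaf x P w) ⊎ Two x P 1 → All (Credit x P) (3 ∷ 4 ∷ [])
    credits (inj₂ two) = credit₁ ax 7≤D 8≤P 3 1 two ∷ credit₁ ax 7≤D 8≤P 4 1 two ∷ []
    credits (inj₁ (w , leaf)) = credit₁ ax 7≤D 8≤P 3 2 two ∷ credit₁ ax 7≤D 8≤P 4 2 two ∷ []
      where
      two : Two x P 2
      two = pend₁-two (λ u∈ → u∈) (pend-on-P (proj₁ leaf) (leaf-dist-∷ iso fresh leaf))

  off₂ : 6 ≤ D → suc (suc (suc D)) ≡ n → Outcome 3
  off₂ 6≤D size with next P-connected (≤-trans (s≤s (≤-reflexive length-P)) (≤-trans (n≤1+n _) (≤-reflexive size)))
  ... | x , ax with next (Attached.conn⁺ ax) (≤-reflexive (trans (cong (2 +_) length-P) size))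
  ... | y , ay = cases (neighbours ay)
    where
    open Order (≤-trans (≤ᵇ⇒≤ 3 6 _) 6≤D)
    module X = Attached ax
    module Y = Attached ay
    long : suc D ≤ length (x ∷ P)
    long = m≤n⇒m≤1+n P-long
    7≤P : 7 ≤ length P
    7≤P = ≤-trans (s≤s 6≤D) P-long
    8≤xP : 8 ≤ length (x ∷ P)
    8≤xP = s≤s 7≤P
    uniq : Unique (y ∷ x ∷ P)
    uniq = ∉⇒unique Y.fresh (∉⇒unique X.fresh P-unique)
    span : length (y ∷ x ∷ P) ≡ n
    span = trans (cong (2 +_) length-P) size
    iso : Isometric (y ∷ x ∷ P)
    iso = isometric-full (full⇒∈ uniq span)
    finish : ∀ {as} → Progress (y ∷ x ∷ P) as → 3 ≤ length as → Outcome 3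
    finish pr le = outcome uniq span pr le
    cases : (∃ λ w → Leaf y (x ∷ P) w) ⊎ Two y (x ∷ P) 1 → Outcome 3
    cases (inj₂ two) = finish (add ay long (add ax P-long P-progress [] []) (2 ∷ 3 ∷ 4 ∷ [])
      (credit₁ ay 6≤D 8≤xP 2 1 two ∷ credit₁ ay 6≤D 8≤xP 3 1 two ∷ credit₁ ay 6≤D 8≤xP 4 1 two ∷ [])) ≤-refl
    cases (inj₁ (w , leaf)) = cases-x (neighbours ax)
      where
      dy : ∀ {u} → u ∈ x ∷ P → d y u ≡ suc (d w u)
      dy = leaf-dist-∷ iso Y.fresh leaf
      iso-x : Isometric (x ∷ P)
      iso-x = peel iso Y.fresh leaf
      cases-x : (∃ λ w → Leaf x P w) ⊎ Two x P 1 → Outcome 3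
      -- Seven vertices of `P` allow `x` credits only up to threshold 3; the one at 4 is left to
      -- `y`, which sees eight.
      cases-x (inj₂ two) = finish (add ay long (add ax P-long P-progress (2 ∷ 3 ∷ [])
        (credit₁ ax 6≤D 7≤P 2 1 two ∷ credit₁ ax 6≤D 7≤P 3 1 two ∷ [])) (4 ∷ [])
        (credit₁ ay 6≤D 8≤xP 4 2 (two-y (proj₁ leaf) dy) ∷ [])) ≤-refl
        where
        two-y : ∀ {w} → w ∈ x ∷ P → (∀ {u} → u ∈ x ∷ P → d y u ≡ suc (d w u)) → Two y (x ∷ P) 2
        two-y (here refl) dy = two-lift there dy two
        two-y (there w∈) dy = pend₁-two there (pend-on-P w∈ (dy ∘ there))
      cases-x (inj₁ (w′ , leaf′)) = cases-y (proj₁ leaf) dy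
        where
        pend-x : ∃ (Pend 1 x)
        pend-x = pend-on-P (proj₁ leaf′) (leaf-dist-∷ iso-x X.fresh leaf′)
        progress-x : Progress (x ∷ P) (3 ∷ [])
        progress-x = add ax P-long P-progress (3 ∷ []) (credit₁ ax 6≤D 7≤P 3 2 (pend₁-two (λ u∈ → u∈) pend-x) ∷ [])
        cases-y : ∀ {w} → w ∈ x ∷ P → (∀ {u} → u ∈ x ∷ P → d y u ≡ suc (d w u)) → Outcome 3
        cases-y (there w∈) dy = finish (add ay long progress-x (3 ∷ 4 ∷ [])
          (credit₁ ay 6≤D 8≤xP 3 2 two ∷ credit₁ ay 6≤D 8≤xP 4 2 two ∷ [])) ≤-refl
          where
          two : Two y (x ∷ P) 2
          two = pend₁-two there (pend-on-P w∈ (dy ∘ there))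
        -- `y`, `x` form a pendant path of length 2, which doubles the levels 3 and 4 around `y`.
        -- Level 3 pays at threshold 4; threshold 5 would need ten vertices for a single level, so
        -- both levels are spent on it.
        cases-y (here refl) dy = finish (add ay long progress-x (4 ∷ 5 ∷ [])
          (credit₁ ay 6≤D 8≤xP 4 3 two₃ ∷ credit₂ ay 6≤D 8≤xP 5 3 4 two₃ two₄ ∷ [])) ≤-refl
          where
          pend-y : Pend 2 y (proj₁ pend-x)
          pend-y = pend-pend (dy ∘ there) (proj₂ pend-x)
          two₃ : Two y (x ∷ P) 3
          two₃ = pend₂-two there pend-y
          two₄ : Two y (x ∷ P) 4
          two₄ = pend-two there pend-y 2 (s≤s z≤n) ≤-refl

  off₃ : 5 ≤ D → suc (suc (suc (suc D))) ≡ n → Outcome 3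
  off₃ 5≤D size with next P-connected (≤-trans (s≤s (≤-reflexive length-P)) (≤-trans (m≤n+m _ 2) (≤-reflexive size)))
  ... | x , ax with next (Attached.conn⁺ ax) (≤-trans (s≤s (s≤s (≤-reflexive length-P))) (≤-trans (n≤1+n _) (≤-reflexive size)))
  ... | y , ay with next (Attached.conn⁺ ay) (≤-reflexive (trans (cong (3 +_) length-P) size))
  ... | z , az = cases (neighbours az)
    where
    open Order (≤-trans (≤ᵇ⇒≤ 3 5 _) 5≤D)
    module X = Attached ax
    module Y = Attached ay
    module Z = Attached az
    6≤P : 6 ≤ length P
    6≤P = ≤-trans (s≤s 5≤D) P-long
    long-x : suc D ≤ length (x ∷ P)
    long-x = m≤n⇒m≤1+n P-long
    long-y : suc D ≤ length (y ∷ x ∷ P)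
    long-y = m≤n⇒m≤1+n long-x
    uniq : Unique (z ∷ y ∷ x ∷ P)
    uniq = ∉⇒unique Z.fresh (∉⇒unique Y.fresh (∉⇒unique X.fresh P-unique))
    span : length (z ∷ y ∷ x ∷ P) ≡ n
    span = trans (cong (3 +_) length-P) size
    iso : Isometric (z ∷ y ∷ x ∷ P)
    iso = isometric-full (full⇒∈ uniq span)
    finish : ∀ {as} → Progress (z ∷ y ∷ x ∷ P) as → 3 ≤ length as → Outcome 3
    finish pr le = outcome uniq span pr le
    credit-x : ∀ t r {_ : T (1 ≤ᵇ r)} {_ : T (r <ᵇ t)} {_ : T (t ≤ᵇ 5)} {_ : T (t + t ≤ᵇ 6)} → Two x P r → Credit x P t
    credit-x t r {a} {b} {c} {e} = credit₁ ax 5≤D 6≤P t r {a} {b} {c} {e}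
    credit-y : ∀ t r {_ : T (1 ≤ᵇ r)} {_ : T (r <ᵇ t)} {_ : T (t ≤ᵇ 5)} {_ : T (t + t ≤ᵇ 7)} → Two y (x ∷ P) r → Credit y (x ∷ P) t
    credit-y t r {a} {b} {c} {e} = credit₁ ay 5≤D (s≤s 6≤P) t r {a} {b} {c} {e}
    credit-z : ∀ t r {_ : T (1 ≤ᵇ r)} {_ : T (r <ᵇ t)} {_ : T (t ≤ᵇ 5)} {_ : T (t + t ≤ᵇ 8)} →
      Two z (y ∷ x ∷ P) r → Credit z (y ∷ x ∷ P) t
    credit-z t r {a} {b} {c} {e} = credit₁ az 5≤D (s≤s (s≤s 6≤P)) t r {a} {b} {c} {e}
    Seen : V → Set
    Seen w = ∀ {u} → u ∈ y ∷ x ∷ P → d z u ≡ suc (d w u)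
    -- When `z` is a leaf, it contributes the third credit, at threshold 4, in every branch except
    -- the pendant path `z`, `y`, `x`.
    on-P : ∀ {w} → w ∈ P → Seen w → Credit z (y ∷ x ∷ P) 4
    on-P w∈ dz = credit-z 4 2 (pend₁-two (there ∘ there) (pend-on-P w∈ (dz ∘ there ∘ there)))
    on-pend : ∀ {w} → ∃ (Pend 1 w) → Seen w → Credit z (y ∷ x ∷ P) 4
    on-pend (i , pd) dz = credit-z 4 3 (pend₂-two (there ∘ there) (pend-pend (dz ∘ there ∘ there) pd))
    cases : (∃ λ w → Leaf z (y ∷ x ∷ P) w) ⊎ Two z (y ∷ x ∷ P) 1 → Outcome 3
    cases (inj₂ two) = finish (add az long-y (add ay long-x (add ax P-long P-progress [] []) [] []) (2 ∷ 3 ∷ 4 ∷ [])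
      (credit-z 2 1 two ∷ credit-z 3 1 two ∷ credit-z 4 1 two ∷ [])) ≤-refl
    cases (inj₁ (w , leaf)) = cases-y (neighbours ay)
      where
      dz : Seen w
      dz = leaf-dist-∷ iso Z.fresh leaf
      iso-y : Isometric (y ∷ x ∷ P)
      iso-y = peel iso Z.fresh leaf
      cases-y : (∃ λ w → Leaf y (x ∷ P) w) ⊎ Two y (x ∷ P) 1 → Outcome 3
      cases-y (inj₂ two) = finish (add az long-y (add ay long-x (add ax P-long P-progress [] []) (2 ∷ 3 ∷ [])
        (credit-y 2 1 two ∷ credit-y 3 1 two ∷ [])) (4 ∷ []) (last (proj₁ leaf) dz ∷ [])) ≤-refl
        where
        -- Since `y` is no leaf, it cannot be peeled, and `x ∷ P` need not be isometric. So the
        -- neighbours of `x` are examined in `y ∷ P`: two of them double level 2 around `z`, and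
        -- otherwise `x` is a leaf of the isometric set `y ∷ x ∷ P`.
        last-x : Seen x → Leaf x (y ∷ P) X.anchor ⊎ Two x (y ∷ P) 1 → Credit z (y ∷ x ∷ P) 4
        last-x dz (inj₂ two-x) = credit-z 4 2 (two-lift y∷P⊆ dz two-x)
          where
          y∷P⊆ : ∀ {u} → u ∈ y ∷ P → u ∈ y ∷ x ∷ P
          y∷P⊆ (here e) = here e
          y∷P⊆ (there u∈) = there (there u∈)
        last-x dz (inj₁ (_ , xa , only)) = on-pend (pend-on-P X.anchor∈ dx) dz
          where
          only′ : ∀ {u} → u ∈ y ∷ x ∷ P → d x u ≡ 1 → u ≡ X.anchor
          only′ (here e) = only (here e)
          only′ (there (here refl)) e = contradiction e not-self
          only′ (there (there u∈)) = only (there u∈)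
          dx : ∀ {u} → u ∈ P → d x u ≡ suc (d X.anchor u)
          dx u∈ = leaf-dist iso-y (there (here refl)) (there (there X.anchor∈) , xa , only′)
            (there (there u∈)) (λ { refl → X.fresh u∈ })
        last : ∀ {w} → w ∈ y ∷ x ∷ P → Seen w → Credit z (y ∷ x ∷ P) 4
        last (here refl) dz = credit-z 4 2 (two-lift there dz two)
        last (there (here refl)) dz = last-x dz (leaf-or-two (there X.anchor∈) X.edge)
        last (there (there w∈)) dz = on-P w∈ dz
      cases-y (inj₁ (w′ , leaf′)) = cases-x (neighbours ax)
        where
        dy : ∀ {u} → u ∈ x ∷ P → d y u ≡ suc (d w′ u)
        dy = leaf-dist-∷ iso-y Y.fresh leaf′
        cases-x : (∃ λ w → Leaf x P w) ⊎ Two x P 1 → Outcome 3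
        cases-x (inj₂ two) = finish (add az long-y (add ay long-x (add ax P-long P-progress (2 ∷ 3 ∷ [])
          (credit-x 2 1 two ∷ credit-x 3 1 two ∷ [])) [] []) (4 ∷ []) (last (proj₁ leaf) dz ∷ [])) ≤-refl
          where
          last-y : ∀ {w′} → w′ ∈ x ∷ P → (∀ {u} → u ∈ x ∷ P → d y u ≡ suc (d w′ u)) → Seen y → Credit z (y ∷ x ∷ P) 4
          last-y (here refl) dy dz = credit-z 4 3 (two-lift (there ∘ there) dz (two-lift (λ u∈ → u∈) (dy ∘ there) two))
          last-y (there w′∈) dy dz = on-pend (pend-on-P w′∈ (dy ∘ there)) dz
          last : ∀ {w} → w ∈ y ∷ x ∷ P → Seen w → Credit z (y ∷ x ∷ P) 4
          last (here refl) dz = last-y (proj₁ leaf′) dy dz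
          last (there (here refl)) dz = credit-z 4 2 (two-lift (there ∘ there) dz two)
          last (there (there w∈)) dz = on-P w∈ dz
        cases-x (inj₁ (w″ , leaf″)) = tree (proj₁ leaf′) dy (proj₁ (proj₂ leaf′))
          where
          pend-x : ∃ (Pend 1 x)
          pend-x = pend-on-P (proj₁ leaf″) (leaf-dist-∷ (peel iso-y Y.fresh leaf′) X.fresh leaf″)
          progress-x : Progress (x ∷ P) (3 ∷ [])
          progress-x = add ax P-long P-progress (3 ∷ []) (credit-x 3 2 (pend₁-two (λ u∈ → u∈) pend-x) ∷ [])
          tree : ∀ {w′} → w′ ∈ x ∷ P → (∀ {u} → u ∈ x ∷ P → d y u ≡ suc (d w′ u)) → d y w′ ≡ 1 → Outcome 3
          tree (there w′∈) dy _ = finish (add az long-y (add ay long-x progress-x (3 ∷ [])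
            (credit-y 3 2 (pend₁-two there pend-y) ∷ [])) (4 ∷ []) (last (proj₁ leaf) dz ∷ [])) ≤-refl
            where
            pend-y : ∃ (Pend 1 y)
            pend-y = pend-on-P w′∈ (dy ∘ there)
            last : ∀ {w} → w ∈ y ∷ x ∷ P → Seen w → Credit z (y ∷ x ∷ P) 4
            last (here refl) dz = on-pend pend-y dz
            last (there (here refl)) dz = on-pend pend-x dz
            last (there (there w∈)) dz = on-P w∈ dz
          tree (here refl) dy yx = chain (proj₁ leaf) dz
            where
            pend-y : Pend 2 y (proj₁ pend-x)
            pend-y = pend-pend (dy ∘ there) (proj₂ pend-x)
            two₃ : Two y (x ∷ P) 3
            two₃ = pend₂-two there pend-y
            two₄ : Two y (x ∷ P) 4
            two₄ = pend-two there pend-y 2 (s≤s z≤n) ≤-refl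
            progress-y : Progress (y ∷ x ∷ P) (5 ∷ 3 ∷ [])
            progress-y = add ay long-x progress-x (5 ∷ []) (credit₂ ay 5≤D (s≤s 6≤P) 5 3 4 two₃ two₄ ∷ [])
            chain : ∀ {w} → w ∈ y ∷ x ∷ P → Seen w → Outcome 3
            chain (there (there w∈)) dz = finish (add az long-y progress-y (4 ∷ []) (on-P w∈ dz ∷ [])) ≤-refl
            chain (there (here refl)) dz = finish (add az long-y progress-y (4 ∷ [])
              (credit-z 4 2 (fork-two dz (Y.fresh ∘ there) (here refl) (there ∘ there) yx (proj₂ pend-x)) ∷ [])) ≤-refl
            -- A pendant path of length 3 forces `D ≥ 6`; then `x ∷ P` has eight vertices and `y`
            -- earns threshold 4 as well as 5.
            chain (here refl) dz = finish (add az long-y (add ay long-x progress-x (4 ∷ 5 ∷ [])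
              (credit₁ ay 6≤D 8≤xP 4 3 two₃ ∷ credit₂ ay 6≤D 8≤xP 5 3 4 two₃ two₄ ∷ [])) [] []) ≤-refl
              where
              6≤D : 6 ≤ D
              6≤D = pend₃-long (pend-pend (dz ∘ there ∘ there) pend-y)
              8≤xP : 8 ≤ length (x ∷ P)
              8≤xP = s≤s (≤-trans (s≤s 6≤D) P-long)

  off₄ : 4 ≤ D → suc (suc (suc (suc (suc D)))) ≡ n → Outcome 1
  off₄ 4≤D size with next P-connected (≤-trans (s≤s (≤-reflexive length-P)) (≤-trans (m≤n+m _ 3) (≤-reflexive size)))
  ... | x , ax with next (Attached.conn⁺ ax) (≤-trans (s≤s (s≤s (≤-reflexive length-P))) (≤-trans (m≤n+m _ 2) (≤-reflexive size)))
  ... | y , ay with next (Attached.conn⁺ ay) (≤-trans (s≤s (s≤s (s≤s (≤-reflexive length-P)))) (≤-trans (n≤1+n _) (≤-reflexive size)))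
  ... | z , az with next (Attached.conn⁺ az) (≤-reflexive (trans (cong (4 +_) length-P) size))
  ... | q , aq = cases (neighbours aq)
    where
    open Order (≤-trans (≤ᵇ⇒≤ 3 4 _) 4≤D)
    module X = Attached ax
    module Y = Attached ay
    module Z = Attached az
    module Q = Attached aq
    5≤P : 5 ≤ length P
    5≤P = ≤-trans (s≤s 4≤D) P-long
    long-x : suc D ≤ length (x ∷ P)
    long-x = m≤n⇒m≤1+n P-long
    long-y : suc D ≤ length (y ∷ x ∷ P)
    long-y = m≤n⇒m≤1+n long-x
    long-z : suc D ≤ length (z ∷ y ∷ x ∷ P)
    long-z = m≤n⇒m≤1+n long-y
    uniq : Unique (q ∷ z ∷ y ∷ x ∷ P)
    uniq = ∉⇒unique Q.fresh (∉⇒unique Z.fresh (∉⇒unique Y.fresh (∉⇒unique X.fresh P-unique)))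
    span : length (q ∷ z ∷ y ∷ x ∷ P) ≡ n
    span = trans (cong (4 +_) length-P) size
    iso : Isometric (q ∷ z ∷ y ∷ x ∷ P)
    iso = isometric-full (full⇒∈ uniq span)
    plain-x : Progress (x ∷ P) []
    plain-x = add ax P-long P-progress [] []
    plain-y : Progress (y ∷ x ∷ P) []
    plain-y = add ay long-x plain-x [] []
    from-q : ∀ {as} → 1 ≤ length as → Progress (q ∷ z ∷ y ∷ x ∷ P) as → Outcome 1
    from-q le pr = outcome uniq span pr le
    from-z : ∀ {as} → 1 ≤ length as → Progress (z ∷ y ∷ x ∷ P) as → Outcome 1
    from-z le pr = from-q le (add aq long-z pr [] [])
    from-y : ∀ {as} → 1 ≤ length as → Progress (y ∷ x ∷ P) as → Outcome 1
    from-y le pr = from-z le (add az long-y pr [] [])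
    from-x : ∀ {as} → 1 ≤ length as → Progress (x ∷ P) as → Outcome 1
    from-x le pr = from-y le (add ay long-x pr [] [])
    cases : (∃ λ w → Leaf q (z ∷ y ∷ x ∷ P) w) ⊎ Two q (z ∷ y ∷ x ∷ P) 1 → Outcome 1
    cases (inj₂ two) = from-q ≤-refl (add aq long-z (add az long-y plain-y [] []) (2 ∷ [])
      (credit₁ aq 4≤D (s≤s (s≤s (s≤s 5≤P))) 2 1 two ∷ []))
    cases (inj₁ (_ , leaf-q)) = cases-z (neighbours az)
      where
      iso-z : Isometric (z ∷ y ∷ x ∷ P)
      iso-z = peel iso Q.fresh leaf-q
      cases-z : (∃ λ w → Leaf z (y ∷ x ∷ P) w) ⊎ Two z (y ∷ x ∷ P) 1 → Outcome 1
      cases-z (inj₂ two) = from-z ≤-refl (add az long-y plain-y (2 ∷ []) (credit₁ az 4≤D (s≤s (s≤s 5≤P)) 2 1 two ∷ []))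
      cases-z (inj₁ (_ , leaf-z)) = cases-y (neighbours ay)
        where
        iso-y : Isometric (y ∷ x ∷ P)
        iso-y = peel iso-z Z.fresh leaf-z
        cases-y : (∃ λ w → Leaf y (x ∷ P) w) ⊎ Two y (x ∷ P) 1 → Outcome 1
        cases-y (inj₂ two) = from-y ≤-refl (add ay long-x plain-x (2 ∷ []) (credit₁ ay 4≤D (s≤s 5≤P) 2 1 two ∷ []))
        cases-y (inj₁ (_ , leaf-y)) = cases-x (neighbours ax)
          where
          cases-x : (∃ λ w → Leaf x P w) ⊎ Two x P 1 → Outcome 1
          cases-x (inj₂ two) = from-x ≤-refl (add ax P-long P-progress (2 ∷ []) (credit₁ ax 4≤D 5≤P 2 1 two ∷ []))
          cases-x (inj₁ (_ , leaf-x)) =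
            tree (proj₁ leaf-y) (leaf-dist-∷ iso-y Y.fresh leaf-y) (proj₁ (proj₂ leaf-y))
            where
            pend-x : ∃ (Pend 1 x)
            pend-x = pend-on-P (proj₁ leaf-x) (leaf-dist-∷ (peel iso-y Y.fresh leaf-y) X.fresh leaf-x)
            -- A doubled level 2 credits threshold 3 only among six vertices, and `P` is sure to
            -- have just five. So the credit comes from `y`, from `z`, or from a longer geodesic.
            tree : ∀ {w} → w ∈ x ∷ P → (∀ {u} → u ∈ x ∷ P → d y u ≡ suc (d w u)) → d y w ≡ 1 → Outcome 1
            tree (there w∈) dy _ = from-y ≤-refl (add ay long-x plain-x (3 ∷ [])
              (credit₁ ay 4≤D (s≤s 5≤P) 3 2 (pend₁-two there (pend-on-P w∈ (dy ∘ there))) ∷ []))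
            tree (here refl) dy yx = chain (proj₁ leaf-z) (leaf-dist-∷ iso-z Z.fresh leaf-z)
              where
              credited-z : Two z (y ∷ x ∷ P) 2 → Outcome 1
              credited-z two = from-z ≤-refl (add az long-y plain-y (3 ∷ []) (credit₁ az 4≤D (s≤s (s≤s 5≤P)) 3 2 two ∷ []))
              chain : ∀ {w} → w ∈ y ∷ x ∷ P → (∀ {u} → u ∈ y ∷ x ∷ P → d z u ≡ suc (d w u)) → Outcome 1
              chain (there (there w∈)) dz =
                credited-z (pend₁-two (there ∘ there) (pend-on-P w∈ (dz ∘ there ∘ there)))
              chain (there (here refl)) dz =
                credited-z (fork-two dz (Y.fresh ∘ there) (here refl) (there ∘ there) yx (proj₂ pend-x))
              -- The pendant path `z`, `y`, `x` forces `D ≥ 6`, and then `P` is already large enough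
              -- for the credit of `x`.
              chain (here refl) dz = from-x ≤-refl (add ax P-long P-progress (3 ∷ [])
                (credit₁ ax 6≤D (≤-trans (s≤s 6≤D) P-long) 3 2 (pend₁-two (λ u∈ → u∈) pend-x) ∷ []))
                where
                6≤D : 6 ≤ D
                6≤D = pend₃-long (pend-pend (dz ∘ there ∘ there) (pend-pend (dy ∘ there) (proj₂ pend-x)))

-- Totals of the path and its thresholds above the diameter

pathW pathE : ℕ → ℕ
pathW N = ∑₁ N (λ t → tri (suc N ∸ t))
pathE N = ∑₁ N (λ t → M t (suc N ∸ t))

double≤tri : ∀ k → (3 + k) + (3 + k) ≤ tri (3 + k)
double≤tri zero = ≤-refl
double≤tri (suc k) = begin
  4 + k + (4 + k)              ≡⟨ shift k ⟩
  2 + ((3 + k) + (3 + k))      ≤⟨ +-mono-≤ (m≤m+n 2 (2 + k)) (double≤tri k) ⟩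
  (4 + k) + tri (3 + k)        ∎
  where
  open ≤-Reasoning
  shift : ∀ k → 4 + k + (4 + k) ≡ 2 + ((3 + k) + (3 + k))
  shift = solve-∀

-- The slack 2 is one for the possible debt at diameter 2 and one for strictness. The surplus starts
-- at 35 - 30, and from then on every term of `tri` dominates.
tail-bound : ∀ m → 2 + ∑₁ (5 + m) (λ k → k + k) ≤ ∑₁ (5 + m) tri
tail-bound zero = ≤ᵇ⇒≤ 32 35 _
tail-bound (suc m) = begin
  2 + ((6 + m) + (6 + m) + ∑₁ (5 + m) (λ k → k + k)) ≡⟨ shift ((6 + m) + (6 + m)) _ ⟩
  (6 + m) + (6 + m) + (2 + ∑₁ (5 + m) (λ k → k + k)) ≤⟨ +-mono-≤ (double≤tri (3 + m)) (tail-bound m) ⟩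
  tri (6 + m) + ∑₁ (5 + m) tri                       ∎
  where
  open ≤-Reasoning
  shift : ∀ a b → 2 + (a + b) ≡ a + (2 + b)
  shift = solve-∀

-- Summing over thresholds

module Totals {n : ℕ} (μ : GraphMetric n) where
  open Stage μ

  weight : List V → ℕ
  weight [] = 0
  weight (x ∷ S) = ∑ (d x) S + weight S

  eccSum : List V → ℕ
  eccSum L = ∑ (eccIn L) L

  weight-↭ : ∀ {L L′} → L ↭ L′ → weight L ≡ weight L′
  weight-↭ ↭.refl = refl
  weight-↭ (↭.prep x p) = cong₂ _+_ (∑-↭ (d x) p) (weight-↭ p)
  weight-↭ (↭.swap {xs = S} {ys = S′} x y p) = begin
    (d x y + ∑ (d x) S) + (∑ (d y) S + weight S)      ≡⟨ cong₂ _+_ (cong₂ _+_ (d-sym x y) (∑-↭ (d x) p)) (cong₂ _+_ (∑-↭ (d y) p) (weight-↭ p)) ⟩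
    (d y x + ∑ (d x) S′) + (∑ (d y) S′ + weight S′)   ≡⟨ interchange (d y x) _ _ _ ⟩
    (d y x + ∑ (d y) S′) + (∑ (d x) S′ + weight S′)   ∎
    where open ≡-Reasoning
  weight-↭ (↭.trans p q) = trans (weight-↭ p) (weight-↭ q)

  eccIn-↭ : ∀ {L L′} → L ↭ L′ → ∀ y → eccIn L y ≡ eccIn L′ y
  eccIn-↭ ↭.refl y = refl
  eccIn-↭ (↭.prep x p) y = cong (d y x ⊔_) (eccIn-↭ p y)
  eccIn-↭ (↭.swap {xs = S} {ys = S′} x z p) y = begin
    d y x ⊔ (d y z ⊔ eccIn S y)    ≡⟨ cong (λ e → d y x ⊔ (d y z ⊔ e)) (eccIn-↭ p y) ⟩
    d y x ⊔ (d y z ⊔ eccIn S′ y)   ≡⟨ sym (⊔-assoc (d y x) _ _) ⟩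
    (d y x ⊔ d y z) ⊔ eccIn S′ y   ≡⟨ cong (_⊔ eccIn S′ y) (⊔-comm (d y x) (d y z)) ⟩
    (d y z ⊔ d y x) ⊔ eccIn S′ y   ≡⟨ ⊔-assoc (d y z) _ _ ⟩
    d y z ⊔ (d y x ⊔ eccIn S′ y)   ∎
    where open ≡-Reasoning
  eccIn-↭ (↭.trans p q) y = trans (eccIn-↭ p y) (eccIn-↭ q y)

  eccSum-↭ : ∀ {L L′} → L ↭ L′ → eccSum L ≡ eccSum L′
  eccSum-↭ {L} {L′} p = trans (∑-cong L (λ {y} _ → eccIn-↭ p y)) (∑-↭ (eccIn L′) p)

  module _ {T : ℕ} (bounded : ∀ x y → d x y ≤ T) where

    weight-layers : ∀ L → weight L ≡ ∑₁ T (λ t → pairs t L)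
    weight-layers [] = sym (∑₁-zero T)
    weight-layers (x ∷ S) = begin
      ∑ (d x) S + weight S
        ≡⟨ cong₂ _+_ (∑-cong S (λ {y} _ → sym (layers T (d x y) (bounded x y)))) (weight-layers S) ⟩
      ∑ (λ y → ∑₁ T (λ t → ⟦ t ≤? d x y ⟧)) S + ∑₁ T (λ t → pairs t S)
        ≡⟨ cong (_+ _) (∑-∑₁ (λ t y → ⟦ t ≤? d x y ⟧) T S) ⟩
      ∑₁ T (λ t → above (d x) t S) + ∑₁ T (λ t → pairs t S)
        ≡⟨ sym (∑₁-+ (λ t → above (d x) t S) (λ t → pairs t S) T) ⟩
      ∑₁ T (λ t → pairs t (x ∷ S)) ∎
      where open ≡-Reasoning

    eccIn-bounded : ∀ L y → eccIn L y ≤ T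
    eccIn-bounded [] y = z≤n
    eccIn-bounded (x ∷ L) y = ⊔-lub (bounded y x) (eccIn-bounded L y)

    eccSum-layers : ∀ L → eccSum L ≡ ∑₁ T (λ t → N t L)
    eccSum-layers L = trans (∑-cong L (λ {y} _ → sym (layers T (eccIn L y) (eccIn-bounded L y))))
      (∑-∑₁ (λ t y → ⟦ t ≤? eccIn L y ⟧) T L)

module PathTotals {n : ℕ} (μ : GraphMetric n) (D : ℕ) (v : ℕ → Fin n)
  (geo : ∀ {i j} → i ≤ D → j ≤ D → GraphMetric.d μ (v i) (v j) ≡ ∣ i - j ∣)
  (diam : ∀ x y → GraphMetric.d μ x y ≤ D) where
  open Geodesic μ D v geo
  open Totals μ

  weight-path : weight P ≡ pathW D
  weight-path = trans (weight-layers diam P) (∑₁-cong D λ { (suc t) _ t≤ →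
    path-pairs t (suc D ∸ suc t) (sym (m+[n∸m]≡n (m≤n⇒m≤1+n t≤))) })

  eccSum-path : eccSum P ≡ pathE D
  eccSum-path = trans (eccSum-layers diam P) (∑₁-cong D λ t 1≤t t≤ →
    path-N t (suc D ∸ t) 1≤t (sym (m+[n∸m]≡n (m≤n⇒m≤1+n t≤))))

module Compare {n : ℕ} (μ : GraphMetric n) (D : ℕ) (v : ℕ → Fin n)
  (geo : ∀ {i j} → i ≤ D → j ≤ D → GraphMetric.d μ (v i) (v j) ≡ ∣ i - j ∣)
  (diam : ∀ x y → GraphMetric.d μ x y ≤ D) where
  open Cases μ D v geo diam public
  open Totals μ public

  -- The `Bound`s are summed over `t ≤ D`. At `t = i + D` only the path contributes, with
  -- `k = m + 1 - i` running through `m`, ..., 1: `tri k` pairs and at most `k + k` vertices.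
  compare : ∀ {L as ls} m → suc (m + D) ≡ n → length L ≡ n → Bounds L as ls → All In-range as → All In-range ls →
    weight L + pathE (m + D) + (∑₁ m tri + length as) ≤ pathW (m + D) + eccSum L + (∑₁ m (λ k → k + k) + length ls)
  compare {L} {as} {ls} m size len (mk-bounds bd) as-in ls-in = begin
    weight L + pathE (m + D) + (∑₁ m tri + length as)
      ≤⟨ +-monoˡ-≤ (∑₁ m tri + length as) (+-monoʳ-≤ (weight L) tail-E) ⟩
    weight L + (Σ2 + ΣM) + (∑₁ m tri + length as)
      ≡⟨ shuffle₁ (weight L) Σ2 ΣM (∑₁ m tri) (length as) ⟩
    (weight L + ΣM + length as) + (∑₁ m tri + Σ2)
      ≤⟨ +-monoˡ-≤ (∑₁ m tri + Σ2) core ⟩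
    (ΣT + eccSum L + length ls) + (∑₁ m tri + Σ2)
      ≡⟨ shuffle₂ ΣT (eccSum L) (length ls) (∑₁ m tri) Σ2 ⟩
    (∑₁ m tri + ΣT) + eccSum L + (Σ2 + length ls)
      ≡⟨ cong (λ z → z + eccSum L + (Σ2 + length ls)) (sym tail-W) ⟩
    pathW (m + D) + eccSum L + (Σ2 + length ls) ∎
    where
    open ≤-Reasoning
    tri′ M′ : ℕ → ℕ
    tri′ t = tri (suc (m + D) ∸ t)
    M′ t = M t (suc (m + D) ∸ t)
    Σ2 ΣM ΣT : ℕ
    Σ2 = ∑₁ m (λ k → k + k)
    ΣM = ∑₁ D M′
    ΣT = ∑₁ D tri′
    shuffle₁ : ∀ w a b c e → w + (a + b) + (c + e) ≡ (w + b + e) + (c + a)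
    shuffle₁ = solve-∀
    shuffle₂ : ∀ a b c e f → (a + b + c) + (e + f) ≡ (e + a) + b + (f + c)
    shuffle₂ = solve-∀
    cancel-D : ∀ i → suc (m + D) ∸ (i + D) ≡ suc m ∸ i
    cancel-D i = trans (cong₂ _∸_ (+-comm (suc m) D) (+-comm i D)) ([m+n]∸[m+o]≡n∸o D (suc m) i)
    tail-W : pathW (m + D) ≡ ∑₁ m tri + ΣT
    tail-W = trans (∑₁-split m D tri′) (cong (_+ ΣT)
      (trans (∑₁-cong m (λ i _ _ → cong tri (cancel-D i))) (∑₁-reverse m tri)))
    tail-E : pathE (m + D) ≤ Σ2 + ΣM
    tail-E = ≤-trans (≤-reflexive (∑₁-split m D M′)) (+-monoˡ-≤ ΣM
      (≤-trans (∑₁-mono m (λ i _ _ → ≤-trans (+-monoʳ-≤ _ (m⊓n≤n (i + D) _)) (≤-reflexive (cong (λ k → k + k) (cancel-D i)))))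
        (≤-reflexive (∑₁-reverse m (λ k → k + k)))))
    core : weight L + ΣM + length as ≤ ΣT + eccSum L + length ls
    core = begin
      weight L + ΣM + length as
        ≡⟨ cong₂ _+_ (cong (_+ ΣM) (weight-layers diam L)) (sym (∑₁-mult as D as-in)) ⟩
      ∑₁ D (λ t → pairs t L) + ΣM + ∑₁ D (mult as)
        ≡⟨ sym (trans (∑₁-+ (λ t → pairs t L + M′ t) (mult as) D) (cong (_+ _) (∑₁-+ (λ t → pairs t L) M′ D))) ⟩
      ∑₁ D (λ t → pairs t L + M′ t + mult as t)
        ≤⟨ ∑₁-mono D (λ t 1≤t t≤ → Bound.holds (bd t 1≤t t≤ (suc (m + D) ∸ t) (size-split t≤))) ⟩
      ∑₁ D (λ t → tri′ t + N t L + mult ls t)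
        ≡⟨ trans (∑₁-+ (λ t → tri′ t + N t L) (mult ls) D) (cong (_+ _) (∑₁-+ tri′ (λ t → N t L) D)) ⟩
      ΣT + ∑₁ D (λ t → N t L) + ∑₁ D (mult ls)
        ≡⟨ cong₂ _+_ (cong (ΣT +_) (sym (eccSum-layers diam L))) (∑₁-mult ls D ls-in) ⟩
      ΣT + eccSum L + length ls ∎
      where
      size-split : ∀ {t} → t ≤ D → length L ≡ t + (suc (m + D) ∸ t)
      size-split t≤ = trans len (trans (sym size) (sym (m+[n∸m]≡n (≤-trans t≤ (m≤n⇒m≤1+n (m≤n+m D m))))))

  record Verdict (m : ℕ) : Set where
    constructor verdict
    field
      {order}  : List V
      unique   : Unique order
      spanning : length order ≡ n
      beaten   : weight order + pathE (m + D) ≤ pathW (m + D) + eccSum order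
      strictly : 1 ≤ m → weight order + pathE (m + D) < pathW (m + D) + eccSum order

  strict : ∀ {a b x y} → a + x ≤ b + y → y < x → a < b
  strict {a} {b} {x} {y} le y<x = +-cancelʳ-≤ y _ _ (≤-trans (≤-reflexive (sym (+-suc a y))) (≤-trans (+-monoʳ-≤ a y<x) le))

  from-outcome : ∀ m {q} → suc (m + D) ≡ n → ∑₁ m (λ k → k + k) < ∑₁ m tri + q → Outcome q → Verdict m
  from-outcome m size gap (outcome uq span (bd , range) enough) = verdict uq span (<⇒≤ lt) (λ _ → lt)
    where
    lt : _
    lt = strict (compare m size span bd range [])
      (≤-trans (s≤s (≤-reflexive (+-identityʳ _))) (≤-trans gap (+-monoʳ-≤ (∑₁ m tri) enough)))

  roomy-P : D ≢ 2 → Roomy P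
  roomy-P D≢2 1 1≤t 1≤D = inj₂ (≤-trans (s≤s 1≤D) P-long)
  roomy-P D≢2 2 _ 2≤D = inj₂ (≤-trans (s≤s (≤∧≢⇒< 2≤D (D≢2 ∘ sym))) P-long)
  roomy-P D≢2 (suc (suc (suc t))) _ _ = inj₁ (s≤s (s≤s (s≤s z≤n)))

  from-bounds : ∀ m {ls} → suc (m + D) ≡ n → 2 + ∑₁ m (λ k → k + k) ≤ ∑₁ m tri → All In-range ls → length ls ≤ 1 →
    (∃ λ L → Unique L × length L ≡ n × Bounds L [] ls) → Verdict m
  from-bounds m {ls} size gap ls-in ≤1 (L , uq , span , bd) = verdict uq span (<⇒≤ lt) (λ _ → lt)
    where
    lt : weight L + pathE (m + D) < pathW (m + D) + eccSum L
    lt = strict (compare m size span bd [] ls-in) (≤-trans (s≤s (+-monoʳ-≤ _ ≤1))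
      (≤-trans (≤-reflexive (cong suc (+-comm _ 1))) (≤-trans gap (m≤m+n _ 0))))

  verdict-many : ∀ m → suc (suc m + D) ≡ n → 2 + ∑₁ (suc m) (λ k → k + k) ≤ ∑₁ (suc m) tri → Verdict (suc m)
  verdict-many m size gap = by-diameter (D ≟ 2)
    where
    -- Diameter 2 gives `t ≤ 2`, and `x ∷ P` has the four vertices that `t + t` asks for.
    room : ∀ x → D ≡ 2 → Roomy (x ∷ P)
    room x D≡2 t _ t≤D = inj₂ (≤-trans (+-mono-≤ (≤-trans t≤D (≤-reflexive D≡2)) (≤-trans t≤D (≤-reflexive D≡2)))
      (≤-reflexive (sym (cong suc (trans length-P (cong suc D≡2))))))
    via : D ≡ 2 → (∃ λ x → Attached x P) → Verdict (suc m)
    via D≡2 (x , ax) = from-bounds (suc m) size gap ((s≤s z≤n , ≤-reflexive (sym D≡2)) ∷ []) ≤-refl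
      (bounds-complete m (trans (cong (λ z → suc (z + m)) length-P) (trans (cong (2 +_) (+-comm D m)) size))
        (Attached.conn⁺ ax) (∉⇒unique (Attached.fresh ax) P-unique) (m≤n⇒m≤1+n P-long) (room x D≡2)
        (bounds-extend-weak D≡2 ax))
    by-diameter : Dec (D ≡ 2) → Verdict (suc m)
    by-diameter (no D≢2) = from-bounds (suc m) size gap [] z≤n
      (bounds-complete (suc m) (trans (cong (_+ suc m) length-P) (trans (cong suc (+-comm D (suc m))) size))
        P-connected P-unique P-long (roomy-P D≢2) P-bounds)
    by-diameter (yes D≡2) = via D≡2
      (next P-connected (≤-trans (s≤s (≤-reflexive length-P)) (≤-trans (s≤s (s≤s (m≤n+m D m))) (≤-reflexive size))))

  judge : ∀ m → suc (m + D) ≡ n → 9 ≤ n → Verdict m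
  judge 0 size 9≤n = verdict P-unique span
    (+-cancelʳ-≤ 0 _ _ (compare 0 size span P-bounds [] [])) (λ ())
    where
    span : length P ≡ n
    span = trans length-P size
  judge 1 size 9≤n = from-outcome 1 size ≤-refl (off₁ (m≤n+o⇒m∸n≤o 9 2 (≤-trans 9≤n (≤-reflexive (sym size)))) size)
  judge 2 size 9≤n = from-outcome 2 size ≤-refl (off₂ (m≤n+o⇒m∸n≤o 9 3 (≤-trans 9≤n (≤-reflexive (sym size)))) size)
  judge 3 size 9≤n = from-outcome 3 size ≤-refl (off₃ (m≤n+o⇒m∸n≤o 9 4 (≤-trans 9≤n (≤-reflexive (sym size)))) size)
  judge 4 size 9≤n = from-outcome 4 size ≤-refl (off₄ (m≤n+o⇒m∸n≤o 9 5 (≤-trans 9≤n (≤-reflexive (sym size)))) size)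
  judge (suc (suc (suc (suc (suc m))))) size 9≤n = verdict-many (4 + m) size (tail-bound m)

-- Connects the order in which vertices were added with the order `allFin` of the definitions;
-- weight and eccentricity sum are invariant under permutation.
spanning⇒↭ : ∀ {n} {L : List (Fin n)} → Unique L → length L ≡ n → L ↭ allFin n
spanning⇒↭ {n} uq len = ∼bag⇒↭ (unique∧set⇒bag uq (allFin⁺ n)
  (λ {x} → mk⇔ (λ _ → ∈-allFin x) (λ _ → full⇒∈ uq len x)))

-- Booleans and bounded search

T-ext : ∀ {a b} → (T a → T b) → (T b → T a) → a ≡ b
T-ext {false} {false} f g = refl
T-ext {false} {true} f g = ⊥-elim (g _)
T-ext {true} {false} f g = ⊥-elim (f _)
T-ext {true} {true} f g = refl

leastBelow-least : ∀ b p {k} → k < b → T (p k) → (∀ {j} → j < k → ¬ T (p j)) → leastBelow b p ≡ k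
leastBelow-least (suc b) p {k} k<b pk min with p zero in eq
leastBelow-least (suc b) p {zero} k<b pk min | true = refl
leastBelow-least (suc b) p {suc k} k<b pk min | true = contradiction (subst T (sym eq) _) (min (s≤s z≤n))
leastBelow-least (suc b) p {zero} k<b pk min | false = contradiction (subst T eq pk) (λ ())
leastBelow-least (suc b) p {suc k} (s≤s k<b) pk min | false =
  cong suc (leastBelow-least b (p ∘ suc) k<b pk (λ j<k → min (s≤s j<k)))

least : ∀ (p : ℕ → Bool) k → T (p k) → ∃ λ l → T (p l) × (∀ {j} → j < l → ¬ T (p j))
least p k pk with p zero in eq
... | true = 0 , subst T (sym eq) _ , λ ()
least p zero pk | false = contradiction (subst T eq pk) (λ ())
least p (suc k) pk | false with least (p ∘ suc) k pk
... | l , pl , min = suc l , pl , λ { {zero} _ → subst T eq ; {suc j} (s≤s j<l) → min j<l }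

-- Graph distance

module Reach {n : ℕ} (G : Graph n) where

  reach-refl : ∀ u → T (reach G 0 u u)
  reach-refl u = ≡⇒≡ᵇ (toℕ u) (toℕ u) refl

  reach-0 : ∀ {u v} → T (reach G 0 u v) → u ≡ v
  reach-0 {u} {v} r = toℕ-injective (≡ᵇ⇒≡ (toℕ u) (toℕ v) r)

  reach-weaken : ∀ {k u v} → T (reach G k u v) → T (reach G (suc k) u v)
  reach-weaken r = Equivalence.from T-∨ (inj₁ r)

  reach-cons : ∀ {k u w v} → T (adj G u w) → T (reach G k w v) → T (reach G (suc k) u v)
  reach-cons {k} {u} {w} {v} a r = Equivalence.from T-∨ (inj₂ (any⁺ (λ w → adj G u w ∧ reach G k w v)
    (lose (∈-allFin w) (Equivalence.from T-∧ (a , r)))))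

  reach-uncons : ∀ {k u v} → T (reach G (suc k) u v) → T (reach G k u v) ⊎ ∃ λ w → T (adj G u w) × T (reach G k w v)
  reach-uncons {k} {u} {v} r with Equivalence.to T-∨ r
  ... | inj₁ r′ = inj₁ r′
  ... | inj₂ r′ with find (any⁻ (λ w → adj G u w ∧ reach G k w v) (allFin n) r′)
  ... | w , _ , both = inj₂ (w , Equivalence.to T-∧ both)

  reach-trans : ∀ j {k u w v} → T (reach G j u w) → T (reach G k w v) → T (reach G (j + k) u v)
  reach-trans zero {k} {u} {w} {v} r s = subst (λ z → T (reach G k z v)) (sym (reach-0 {u} {w} r)) s
  reach-trans (suc j) {k} {u} {w} {v} r s with reach-uncons {j} {u} {w} r
  ... | inj₁ r′ = reach-weaken {j + k} {u} {v} (reach-trans j {k} {u} {w} {v} r′ s)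
  ... | inj₂ (x , a , r′) = reach-cons {j + k} {u} {x} {v} a (reach-trans j {k} {x} {w} {v} r′ s)

  reach-sym : ∀ k {u v} → T (reach G k u v) → T (reach G k v u)
  reach-sym zero {u} {v} r = subst (λ z → T (reach G 0 v z)) (sym (reach-0 {u} {v} r)) (reach-refl v)
  reach-sym (suc k) {u} {v} r with reach-uncons {k} {u} {v} r
  ... | inj₁ r′ = reach-weaken {k} {v} {u} (reach-sym k r′)
  ... | inj₂ (w , a , r′) = subst (λ z → T (reach G z v u)) (+-comm k 1)
    (reach-trans k {1} {v} {w} {u} (reach-sym k r′) (reach-cons {0} {w} {u} {u} (subst T (Graph.sym G u w) a) (reach-refl u)))

  -- Distance as a relation, without the cut-off at `n` that is built into `dist`; `isDist-<` shows
  -- that the cut-off is harmless.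
  IsDist : ℕ → Fin n → Fin n → Set
  IsDist k u v = T (reach G k u v) × (∀ {j} → j < k → ¬ T (reach G j u v))

  isDist-≤ : ∀ {k j u v} → IsDist k u v → T (reach G j u v) → k ≤ j
  isDist-≤ (_ , min) r = ≮⇒≥ (λ lt → min lt r)

  isDist-unique : ∀ {k j u v} → IsDist k u v → IsDist j u v → k ≡ j
  isDist-unique {k} {j} {u} {v} p q = ≤-antisym (isDist-≤ {k} {j} {u} {v} p (proj₁ q)) (isDist-≤ {j} {k} {u} {v} q (proj₁ p))

  isDist-step : ∀ {k u v} → IsDist (suc k) u v → ∃ λ w → T (adj G u w) × IsDist k w v
  isDist-step {k} {u} {v} (r , min) with reach-uncons {k} {u} {v} r
  ... | inj₁ r′ = contradiction r′ (min ≤-refl)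
  ... | inj₂ (w , a , r′) = w , a , r′ , λ {j} j<k s → min (s≤s j<k) (reach-cons {j} {u} {w} {v} a s)

  isDist-below : ∀ k {u v} → IsDist k u v → ∀ j → j ≤ k → ∃ λ w → IsDist j w v
  isDist-below zero {u} {v} p zero z≤n = u , p
  isDist-below (suc k) {u} {v} p j j≤ with j ≤? k
  ... | yes j≤k with isDist-step {k} {u} {v} p
  ... | w , _ , q = isDist-below k {w} {v} q j j≤k
  isDist-below (suc k) {u} {v} p j j≤ | no j≰k =
    u , subst (λ z → IsDist z u v) (≤-antisym (≰⇒> j≰k) j≤) p

  -- The vertices on a shortest walk to v have distinct distances to v.
  isDist-< : ∀ {k u v} → IsDist k u v → k < n
  isDist-< {k} {u} {v} p = Fin.injective⇒≤ {f = λ i → proj₁ (met i)} λ {i} {j} e →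
    toℕ-injective (isDist-unique {toℕ i} {toℕ j} {proj₁ (met j)} {v}
      (subst (λ z → IsDist (toℕ i) z v) e (proj₂ (met i))) (proj₂ (met j)))
    where
    met : (i : Fin (suc k)) → ∃ λ w → IsDist (toℕ i) w v
    met i = isDist-below k {u} {v} p (toℕ i) (≤-pred (toℕ<n i))

  dist-unique : ∀ {k u v} → IsDist k u v → dist G u v ≡ k
  dist-unique {k} {u} {v} p = leastBelow-least n (λ k → reach G k u v) (isDist-< {k} {u} {v} p) (proj₁ p) (proj₂ p)

  adj⇒dist≡1 : ∀ {u v} → T (adj G u v) → dist G u v ≡ 1
  adj⇒dist≡1 {u} {v} a = dist-unique {1} {u} {v} (reach-cons {0} {u} {v} {v} a (reach-refl v) ,
      λ { {zero} _ r → loopless r ; {suc _} (s≤s ()) _ })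
    where
    loopless : ¬ T (reach G 0 u v)
    loopless r with reach-0 {u} {v} r
    ... | refl = subst T (irrefl G u) a

  module _ (connected : Connected G) where

    dist-isDist : ∀ u v → IsDist (dist G u v) u v
    dist-isDist u v with connected u v
    ... | k , r with least (λ k → reach G k u v) k r
    ... | l , p = subst (λ z → IsDist z u v) (sym (dist-unique {l} {u} {v} p)) p

    metric : GraphMetric n
    metric = record
      { d        = dist G
      ; d-refl   = λ u → dist-unique {0} {u} {u} (reach-refl u , λ ())
      ; d≡0⇒≡    = λ {u} {v} e → reach-0 {u} {v} (subst (λ z → T (reach G z u v)) e (proj₁ (dist-isDist u v)))
      ; d-sym    = λ u v → dist-unique {dist G v u} {u} {v} (reach-sym (dist G v u) (proj₁ (dist-isDist v u)) ,
          λ {j} j< r → proj₂ (dist-isDist v u) j< (reach-sym j r))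
      ; triangle = λ u v w → isDist-≤ {dist G u w} {dist G u v + dist G v w} {u} {w} (dist-isDist u w)
          (reach-trans (dist G u v) {dist G v w} {u} {v} {w} (proj₁ (dist-isDist u v)) (proj₁ (dist-isDist v w)))
      ; step     = λ {u} {v} {r} e → let w , a , p = isDist-step {r} {u} {v} (subst (λ z → IsDist z u v) e (dist-isDist u v)) in
          w , adj⇒dist≡1 a , dist-unique {r} {w} {v} p
      }

    dist≡1⇒adj : ∀ {u v} → dist G u v ≡ 1 → T (adj G u v)
    dist≡1⇒adj {u} {v} e with isDist-step {0} {u} {v} (subst (λ z → IsDist z u v) e (dist-isDist u v))
    ... | w , a , (r , _) = subst (λ z → T (adj G u z)) (reach-0 {w} {v} r) a

    open Totals metric
    open GraphMetric metric using (d-sym)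

    private
      sum-concatMap : ∀ {A : Set} (f : A → List ℕ) xs → sum (concatMap f xs) ≡ ∑ (sum ∘ f) xs
      sum-concatMap f [] = refl
      sum-concatMap f (x ∷ xs) = trans (sum-++ (f x) (concatMap f xs)) (cong (sum (f x) +_) (sum-concatMap f xs))

      -- Unification reads off the summand of the definition of wiener, whose local helper has no name here.
      summand : ∃ λ (term : Fin n → Fin n → ℕ) → wiener G ≡ sum (concatMap (λ u → map (term u) (allFin n)) (allFin n))
      summand = _ , refl

      term : Fin n → Fin n → ℕ
      term = proj₁ summand

      term-< : ∀ {u v} → toℕ u < toℕ v → term u v ≡ dist G u v
      term-< {u} {v} lt with toℕ u <ᵇ toℕ v | <⇒<ᵇ lt
      ... | true | _ = refl

      term-≥ : ∀ {u v} → toℕ v ≤ toℕ u → term u v ≡ 0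
      term-≥ {u} {v} le with toℕ u <ᵇ toℕ v in eq
      ... | false = refl
      ... | true = contradiction (<ᵇ⇒< (toℕ u) (toℕ v) (subst T (sym eq) _)) (≤⇒≯ le)

      -- Along an increasing list, `term` keeps exactly the pairs whose first entry comes earlier,
      -- which are the pairs of the triangular sum `weight`.
      sorted : ∀ L → AllPairs (λ u v → toℕ u < toℕ v) L → ∑ (λ u → ∑ (term u) L) L ≡ weight L
      sorted [] [] = refl
      sorted (x ∷ S) (x< ∷ S<) = cong₂ _+_
        (cong₂ _+_ (term-≥ {x} {x} ≤-refl) (∑-cong S (λ {y} y∈ → term-< {x} {y} (All.lookup x< y∈))))
        (trans (∑-cong S (λ {y} y∈ → cong (_+ ∑ (term y) S) (term-≥ {y} {x} (<⇒≤ (All.lookup x< y∈))))) (sorted S S<))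

    wiener≡ : wiener G ≡ weight (allFin n)
    wiener≡ = trans (proj₂ summand) (trans (sum-concatMap (λ u → map (term u) (allFin n)) (allFin n))
      (sorted (allFin n) (tabulate⁺-< (λ lt → lt))))

    totalEcc≡ : totalEcc G ≡ eccSum (allFin n)
    totalEcc≡ = ∑-cong (allFin n) (λ {v} _ → cong (foldr _⊔_ 0) (map-cong (λ u → d-sym u v) (allFin n)))

    wiener-spanning : ∀ {L} → Unique L → length L ≡ n → wiener G ≡ weight L
    wiener-spanning uq len = trans wiener≡ (sym (weight-↭ (spanning⇒↭ uq len)))

    totalEcc-spanning : ∀ {L} → Unique L → length L ≡ n → totalEcc G ≡ eccSum L
    totalEcc-spanning uq len = trans totalEcc≡ (sym (eccSum-↭ (spanning⇒↭ uq len)))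

-- Diametral geodesics

argmax : ∀ {n} (f : Fin (suc n) → ℕ) → ∃ λ i → ∀ j → f j ≤ f i
argmax {zero} f = Fin.zero , λ { Fin.zero → ≤-refl }
argmax {suc n} f with argmax (f ∘ Fin.suc)
... | i , max with ≤-total (f (Fin.suc i)) (f Fin.zero)
... | inj₁ le = Fin.zero , λ { Fin.zero → ≤-refl ; (Fin.suc j) → ≤-trans (max j) le }
... | inj₂ le = Fin.suc i , λ { Fin.zero → le ; (Fin.suc j) → max j }

module Diameter {n : ℕ} (μ : GraphMetric n) where
  open Metric μ

  Descent : ℕ → V → V → Set
  Descent D u w = ∃ λ (v : ℕ → V) → v 0 ≡ u × (∀ i → i ≤ D → d (v i) w ≡ D ∸ i) × (∀ i → i < D → d (v i) (v (suc i)) ≡ 1)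

  descent : ∀ D {u w} → d u w ≡ D → Descent D u w
  descent zero {u} e = (λ _ → u) , refl , (λ { zero _ → e }) , λ _ ()
  descent (suc D) {u} {w} e with step e
  ... | x , ux , e′ with descent D e′
  ... | v , v₀ , down , edges = v⁺ , refl , down⁺ , edges⁺
    where
    v⁺ : ℕ → V
    v⁺ zero = u
    v⁺ (suc i) = v i
    down⁺ : ∀ i → i ≤ suc D → d (v⁺ i) w ≡ suc D ∸ i
    down⁺ zero _ = e
    down⁺ (suc i) (s≤s i≤) = down i i≤
    edges⁺ : ∀ i → i < suc D → d (v⁺ i) (v⁺ (suc i)) ≡ 1
    edges⁺ zero _ = trans (cong (d u) v₀) ux
    edges⁺ (suc i) (s≤s i<) = edges i i<

  module _ {D : ℕ} {u w : V} (desc : Descent D u w) where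

    private
      v : ℕ → V
      v = proj₁ desc

      down : ∀ i → i ≤ D → d (v i) w ≡ D ∸ i
      down = proj₁ (proj₂ (proj₂ desc))

      edges : ∀ i → i < D → d (v i) (v (suc i)) ≡ 1
      edges = proj₂ (proj₂ (proj₂ desc))

      upper : ∀ s i → i + s ≤ D → d (v i) (v (i + s)) ≤ s
      upper zero i _ = ≤-reflexive (trans (cong (λ z → d (v i) (v z)) (+-identityʳ i)) (d-refl (v i)))
      upper (suc s) i le = ≤-trans (triangle (v i) (v (suc i)) (v (i + suc s)))
        (+-mono-≤ (≤-reflexive (edges i (≤-trans (≤-reflexive (+-comm 1 i)) (≤-trans (+-monoʳ-≤ i (s≤s z≤n)) le))))
          (subst (λ z → d (v (suc i)) (v z) ≤ s) (sym (+-suc i s))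
            (upper s (suc i) (≤-trans (≤-reflexive (sym (+-suc i s))) le))))

      -- Following edges bounds the distance from above. From below, `v i` and `v j` have distances
      -- `D ∸ i` and `D ∸ j` to `w`, so the triangle inequality separates them by `j ∸ i`.
      forward : ∀ {i j} → i ≤ j → j ≤ D → d (v i) (v j) ≡ j ∸ i
      forward {i} {j} i≤j j≤ = ≤-antisym
        (subst (λ z → d (v i) (v z) ≤ j ∸ i) (m+[n∸m]≡n i≤j) (upper (j ∸ i) i (≤-trans (≤-reflexive (m+[n∸m]≡n i≤j)) j≤)))
        (m≤n+o⇒m∸n≤o j i (+-cancelʳ-≤ (D ∸ j) _ _ (begin
          j + (D ∸ j)                       ≡⟨ m+[n∸m]≡n j≤ ⟩
          D                                 ≡⟨ sym (m+[n∸m]≡n (≤-trans i≤j j≤)) ⟩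
          i + (D ∸ i)                       ≡⟨ cong (i +_) (sym (down i (≤-trans i≤j j≤))) ⟩
          i + d (v i) w                     ≤⟨ +-monoʳ-≤ i (triangle (v i) (v j) w) ⟩
          i + (d (v i) (v j) + d (v j) w)   ≡⟨ cong (λ z → i + (d (v i) (v j) + z)) (down j j≤) ⟩
          i + (d (v i) (v j) + (D ∸ j))     ≡⟨ sym (+-assoc i _ _) ⟩
          i + d (v i) (v j) + (D ∸ j)       ∎)))
        where open ≤-Reasoning

    descent-geodesic : ∀ {i j} → i ≤ D → j ≤ D → d (v i) (v j) ≡ ∣ i - j ∣
    descent-geodesic {i} {j} i≤ j≤ with ≤-total i j
    ... | inj₁ i≤j = trans (forward i≤j j≤) (sym (m≤n⇒∣m-n∣≡n∸m i≤j))
    ... | inj₂ j≤i = trans (d-sym (v i) (v j)) (trans (forward j≤i i≤) (sym (m≤n⇒∣n-m∣≡n∸m j≤i)))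

-- The path graph

module Path (N : ℕ) where

  private
    n : ℕ
    n = suc N
    G : Graph n
    G = pathGraph n

  open Reach G

  pathAdj⇒ : ∀ {u v : Fin n} → T (pathAdj u v) → suc (toℕ u) ≡ toℕ v ⊎ suc (toℕ v) ≡ toℕ u
  pathAdj⇒ {u} {v} a with Equivalence.to T-∨ a
  ... | inj₁ p = inj₁ (≡ᵇ⇒≡ (suc (toℕ u)) (toℕ v) p)
  ... | inj₂ p = inj₂ (≡ᵇ⇒≡ (suc (toℕ v)) (toℕ u) p)

  ⇒pathAdj : ∀ {u v : Fin n} → suc (toℕ u) ≡ toℕ v ⊎ suc (toℕ v) ≡ toℕ u → T (pathAdj u v)
  ⇒pathAdj {u} {v} (inj₁ e) = Equivalence.from T-∨ (inj₁ (≡⇒≡ᵇ (suc (toℕ u)) (toℕ v) e))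
  ⇒pathAdj {u} {v} (inj₂ e) = Equivalence.from (T-∨ {suc (toℕ u) ≡ᵇ toℕ v}) (inj₂ (≡⇒≡ᵇ (suc (toℕ v)) (toℕ u) e))

  consecutive⇒ : ∀ {i j} → ∣ i - j ∣ ≡ 1 → suc i ≡ j ⊎ suc j ≡ i
  consecutive⇒ {zero} {suc zero} refl = inj₁ refl
  consecutive⇒ {suc zero} {zero} refl = inj₂ refl
  consecutive⇒ {suc i} {suc j} e with consecutive⇒ {i} {j} e
  ... | inj₁ p = inj₁ (cong suc p)
  ... | inj₂ p = inj₂ (cong suc p)

  ⇒consecutive : ∀ {i j} → suc i ≡ j ⊎ suc j ≡ i → ∣ i - j ∣ ≡ 1
  ⇒consecutive {zero} (inj₁ refl) = refl
  ⇒consecutive {suc i} (inj₁ refl) = ⇒consecutive {i} (inj₁ refl)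
  ⇒consecutive {_} {zero} (inj₂ refl) = refl
  ⇒consecutive {_} {suc j} (inj₂ refl) = ⇒consecutive {suc j} {j} (inj₂ refl)

  reach⇒≤ : ∀ k {u v} → T (reach G k u v) → ∣ toℕ u - toℕ v ∣ ≤ k
  reach⇒≤ zero {u} {v} r = ≤-reflexive (m≡n⇒∣m-n∣≡0 (cong toℕ (reach-0 {u} {v} r)))
  reach⇒≤ (suc k) {u} {v} r with reach-uncons {k} {u} {v} r
  ... | inj₁ r′ = m≤n⇒m≤1+n (reach⇒≤ k {u} {v} r′)
  ... | inj₂ (w , a , r′) = ≤-trans (∣-∣-triangle (toℕ u) (toℕ w) (toℕ v))
    (+-mono-≤ (≤-reflexive (⇒consecutive (pathAdj⇒ {u} {w} a))) (reach⇒≤ k {w} {v} r′))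

  -- One step from `i` towards `j`; the bound by `i ⊔ j` ensures that the new index is still a
  -- vertex of the path.
  toward : ∀ {k i j} → ∣ i - j ∣ ≡ suc k → ∃ λ l → (suc i ≡ l ⊎ suc l ≡ i) × ∣ l - j ∣ ≡ k × l ≤ i ⊔ j
  toward {k} {zero} {suc j} e = 1 , inj₁ refl , suc-injective e , s≤s z≤n
  toward {k} {suc i} {zero} e = i , inj₂ refl , trans (∣-∣-identityʳ i) (suc-injective e) , n≤1+n i
  toward {k} {suc i} {suc j} e with toward {k} {i} {j} e
  ... | l , inj₁ p , q , r = suc l , inj₁ (cong suc p) , q , s≤s r
  ... | l , inj₂ p , q , r = suc l , inj₂ (cong suc p) , q , s≤s r

  reach-path : ∀ k {u v} → ∣ toℕ u - toℕ v ∣ ≡ k → T (reach G k u v)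
  reach-path zero {u} {v} e with toℕ-injective (∣m-n∣≡0⇒m≡n {toℕ u} {toℕ v} e)
  ... | refl = reach-refl u
  reach-path (suc k) {u} {v} e with toward {k} {toℕ u} {toℕ v} e
  ... | l , adjacent , closer , l≤ = reach-cons {k} {u} {w} {v}
      (⇒pathAdj {u} {w} (subst (λ z → suc (toℕ u) ≡ z ⊎ suc z ≡ toℕ u) (sym w≡) adjacent))
      (reach-path k {w} {v} (trans (cong (λ z → ∣ z - toℕ v ∣) w≡) closer))
    where
    l<n : l < n
    l<n = ≤-trans (s≤s l≤) (⊔-lub (toℕ<n u) (toℕ<n v))
    w : Fin n
    w = fromℕ< l<n
    w≡ : toℕ w ≡ l
    w≡ = toℕ-fromℕ< l<n

  connected : Connected G
  connected u v = ∣ toℕ u - toℕ v ∣ , reach-path _ {u} {v} refl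

  dist-path : ∀ u v → dist G u v ≡ ∣ toℕ u - toℕ v ∣
  dist-path u v = dist-unique {∣ toℕ u - toℕ v ∣} {u} {v}
    (reach-path _ {u} {v} refl , λ {j} j< r → ≤⇒≯ (reach⇒≤ j {u} {v} r) j<)

  vertex : ℕ → Fin n
  vertex i with i <? n
  ... | yes i<n = fromℕ< i<n
  -- A default outside the path; `geo` speaks only of indices at most `N`.
  ... | no _ = Fin.zero

  toℕ-vertex : ∀ {i} → i ≤ N → toℕ (vertex i) ≡ i
  toℕ-vertex {i} i≤ with i <? n
  ... | yes i<n = toℕ-fromℕ< i<n
  ... | no i≮n = contradiction (s≤s i≤) i≮n

  geo : ∀ {i j} → i ≤ N → j ≤ N → dist G (vertex i) (vertex j) ≡ ∣ i - j ∣
  geo {i} {j} i≤ j≤ = trans (dist-path (vertex i) (vertex j)) (cong₂ ∣_-_∣ (toℕ-vertex i≤) (toℕ-vertex j≤))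

  diam : ∀ u v → dist G u v ≤ N
  diam u v = ≤-trans (≤-reflexive (dist-path u v)) (≤-trans (∣m-n∣≤m⊔n (toℕ u) (toℕ v))
    (⊔-lub (≤-pred (toℕ<n u)) (≤-pred (toℕ<n v))))

  open Geodesic (metric connected) N vertex geo using (P-unique; length-P)
  open PathTotals (metric connected) N vertex geo diam

  wiener-path : wiener G ≡ pathW N
  wiener-path = trans (wiener-spanning connected P-unique length-P) weight-path

  totalEcc-path : totalEcc G ≡ pathE N
  totalEcc-path = trans (totalEcc-spanning connected P-unique length-P) eccSum-path

-- An arbitrary connected graph against the path

module Main {N : ℕ} (9≤n : 9 ≤ suc N) (G : Graph (suc N)) (connected : Connected G) where

  private
    n : ℕ
    n = suc N

  open Reach G
  open Diameter (metric connected)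

  private
    μ : GraphMetric n
    μ = metric connected

  farthest : ∃₂ λ u w → ∀ x y → dist G x y ≤ dist G u w
  farthest with argmax (λ x → dist G x (proj₁ (argmax (dist G x))))
  ... | u , max = u , proj₁ (argmax (dist G u)) , λ x y → ≤-trans (proj₂ (argmax (dist G x)) y) (max x)

  D : ℕ
  D = dist G (proj₁ farthest) (proj₁ (proj₂ farthest))

  diam : ∀ x y → dist G x y ≤ D
  diam = proj₂ (proj₂ farthest)

  abstract
    geodesic : Descent D (proj₁ farthest) (proj₁ (proj₂ farthest))
    geodesic = descent D refl

  v : ℕ → Fin n
  v = proj₁ geodesic

  geo : ∀ {i j} → i ≤ D → j ≤ D → dist G (v i) (v j) ≡ ∣ i - j ∣
  geo = descent-geodesic {D} {proj₁ farthest} {proj₁ (proj₂ farthest)} geodesic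

  open Compare μ D v geo diam using (P-long; P-unique; length-P; ∈P⇒; Verdict; module Verdict; judge; weight; eccSum)

  D≤N : D ≤ N
  D≤N = ≤-pred (≤-trans P-long (unique⇒length≤ P-unique))

  m : ℕ
  m = N ∸ D

  size : m + D ≡ N
  size = m∸n+n≡m D≤N

  the-verdict : Verdict m
  the-verdict = judge m (cong suc size) 9≤n

  open Verdict the-verdict

  private
    rewrite-sides : ∀ (_~_ : ℕ → ℕ → Set) → (weight order + pathE (m + D)) ~ (pathW (m + D) + eccSum order) →
      (wiener G + totalEcc (pathGraph n)) ~ (wiener (pathGraph n) + totalEcc G)
    rewrite-sides _~_ = subst₂ _~_
      (cong₂ _+_ (sym (wiener-spanning connected unique spanning)) (trans (cong pathE size) (sym (Path.totalEcc-path N))))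
      (cong₂ _+_ (trans (cong pathW size) (sym (Path.wiener-path N))) (sym (totalEcc-spanning connected unique spanning)))

  upper-bound : wiener G + totalEcc (pathGraph n) ≤ wiener (pathGraph n) + totalEcc G
  upper-bound = rewrite-sides _≤_ beaten

  strict-bound : D < N → wiener G + totalEcc (pathGraph n) < wiener (pathGraph n) + totalEcc G
  strict-bound D<N = rewrite-sides _<_ (strictly (m<n⇒0<n∸m D<N))

  -- The geodesic then contains every vertex, and the distance from `v 0` recovers the index.
  -- Adjacency is distance 1 in both graphs.
  isomorphic : D ≡ N → G ≅ pathGraph n
  isomorphic D≡N = mk↔ₛ′ (v ∘ toℕ) position to-from from-to , edges
    where
    inside : ∀ (i : Fin n) → toℕ i ≤ D
    inside i = ≤-trans (≤-pred (toℕ<n i)) (≤-reflexive (sym D≡N))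
    position : Fin n → Fin n
    position u = fromℕ< (s≤s (≤-trans (diam (v 0) u) D≤N))
    toℕ-position : ∀ u → toℕ (position u) ≡ dist G (v 0) u
    toℕ-position u = toℕ-fromℕ< (s≤s (≤-trans (diam (v 0) u) D≤N))
    to-from : ∀ u → v (toℕ (position u)) ≡ u
    to-from u with ∈P⇒ (full⇒∈ P-unique (trans length-P (cong suc D≡N)) u)
    ... | i , i≤ , refl = cong v (trans (toℕ-position u) (geo z≤n i≤))
    from-to : ∀ i → position (v (toℕ i)) ≡ i
    from-to i = toℕ-injective (trans (toℕ-position (v (toℕ i))) (geo z≤n (inside i)))
    edges : ∀ i j → adj G (v (toℕ i)) (v (toℕ j)) ≡ pathAdj i j
    edges i j = T-ext
      (λ a → Path.⇒pathAdj N {i} {j} (Path.consecutive⇒ N (trans (sym (geo (inside i) (inside j))) (adj⇒dist≡1 a))))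
      (λ a → dist≡1⇒adj connected (trans (geo (inside i) (inside j)) (Path.⇒consecutive N (Path.pathAdj⇒ N {i} {j} a))))

-- Passing to integer differences

⊖-mono : ∀ {a b c e} → a + e ≤ c + b → a ⊖ b ≤ℤ c ⊖ e
⊖-mono {a} {b} {c} {e} le = subst₂ _≤ℤ_
  (trans (cong (_⊖ (e + b)) (+-comm a e)) (ℤ.+-cancelˡ-⊖ e a b))
  (trans (cong₂ _⊖_ (+-comm c b) (+-comm e b)) (ℤ.+-cancelˡ-⊖ b c e))
  (ℤ.⊖-monoˡ-≤ (e + b) le)

⊖-mono-< : ∀ {a b c e} → a + e < c + b → a ⊖ b <ℤ c ⊖ e
⊖-mono-< {a} {b} {c} {e} lt = subst₂ _<ℤ_
  (trans (cong (_⊖ (e + b)) (+-comm a e)) (ℤ.+-cancelˡ-⊖ e a b))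
  (trans (cong₂ _⊖_ (+-comm c b) (+-comm e b)) (ℤ.+-cancelˡ-⊖ b c e))
  (ℤ.⊖-monoˡ-< (e + b) lt)

theorem15 : (n : ℕ) → 9 ≤ n →
    Connected (pathGraph n)
    × (∀ (G : Graph n) → Connected G → wMinusEcc G ≤ℤ wMinusEcc (pathGraph n))
    × (∀ (G : Graph n) → Connected G → wMinusEcc G ≡ wMinusEcc (pathGraph n) → G ≅ pathGraph n)
theorem15 (suc N) 9≤n = Path.connected N , bound , unique-maximum
  where
  path : Graph (suc N)
  path = pathGraph (suc N)
  bound : ∀ G → Connected G → wMinusEcc G ≤ℤ wMinusEcc path
  bound G conn = subst₂ _≤ℤ_ (sym (ℤ.[+m]-[+n]≡m⊖n (wiener G) (totalEcc G)))
    (sym (ℤ.[+m]-[+n]≡m⊖n (wiener path) (totalEcc path)))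
    (⊖-mono {wiener G} {totalEcc G} {wiener path} (Main.upper-bound 9≤n G conn))
  unique-maximum : ∀ G → Connected G → wMinusEcc G ≡ wMinusEcc path → G ≅ path
  -- A diameter below `N` would make the inequality strict, against `eq`.
  unique-maximum G conn eq = Main.isomorphic 9≤n G conn (≤-antisym (Main.D≤N 9≤n G conn) (≮⇒≥ λ D<N →
    ℤ.<-irrefl (trans (sym (ℤ.[+m]-[+n]≡m⊖n (wiener G) (totalEcc G)))
        (trans eq (ℤ.[+m]-[+n]≡m⊖n (wiener path) (totalEcc path))))
      (⊖-mono-< {wiener G} {totalEcc G} {wiener path} (Main.strict-bound 9≤n G conn D<N))))
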